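{- For every integer $n\geq 1$, $$\mathrm{SH}_n=\sum_{\substack{\lambda\vdash n\\ \text{all parts }\lambda_i\text{ odd}}} z_\lambda^{ -1}\,2^{\ell(\lambda)}(n+1)^{\ell(\lambda)-1}\,p_\lambda ,$$ where $\ell(\lambda)$ is the number of nonzero parts of $\lambda$ and $z_\lambda=\prod_i i^{m_i}m_i!$ when $\lambda$ has $m_i$ parts equal to $i$.
   Context: Work in the ring $\Lambda_{\mathbb Q}$ of symmetric functions with rational coefficients in variables $x=(x_1,x_2,\dots)$; $p_k$ denotes the power sum, $p_\lambda=p_{\lambda_1}p_{\lambda_2}\cdots$. For $f\in\Lambda_{\mathbb Q}$, its shiftification $f(x/x)$ is obtained by writing $f$ as a polynomial in the power sums and substituting $p_{2i+1}\mapsto 2p_{2i+1}$ and $p_{2i}\mapsto 0$ for all $i\ge1$ (equivalently, $f(x/x)=(\omega_y f(x,y))|_{y=x}$, where $\omega_y$ is the involution $\omega$ acting on a second variable set $y$ only). A parking function of length $n$ is a sequence $(a_1,\dots,a_n)$ of positive integers whose weakly increasing rearrangement $b_1\le\cdots\le b_n$ satisfies $b_i\le i$ for all $i$. The symmetric group $S_n$ acts on the set of parking functions of length $n$ by permuting coordinates; $\mathrm{PF}_n$ denotes the Frobenius characteristic of this permutation representation ($\mathrm{PF}_0=1$). Define $\mathrm{SH}_n(x)=\mathrm{PF}_n(x/x)$. -}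

module Defs where

open import Data.Bool.Base using (if_then_else_)
open import Data.Fin.Base as Fin using (Fin; toℕ)
open import Data.Fin.Permutation as Perm
  using (Permutation′; _⟨$⟩ʳ_; _⟨$⟩ˡ_; _∘ₚ_; lift₀; transpose; remove)
import Data.Fin.Permutation.Components as PC
import Data.Fin.Properties as Fin
open import Data.Integer.Base using (+_)
open import Data.List.Base as List
  using (List; []; _∷_; _∷ʳ_; length; map; foldr; filter; upTo; allFin;
         concatMap; cartesianProductWith)
open import Data.List.Membership.Propositional using (_∈_)
open import Data.List.Membership.Propositional.Properties
  using (∈-map⁺; ∈-upTo⁺; ∈-upTo⁻; ∈-filter⁺; ∈-cartesianProductWith⁺;
         ∈-concatMap⁺; ∈-allFin)
import Data.List.Properties as List
open import Data.List.Relation.Binary.Permutation.Propositional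
  using (_↭_; prep; swap; ↭-sym)
open _↭_ using () renaming (refl to ↭-refl; trans to ↭-trans′)
open import Data.List.Relation.Binary.Permutation.Propositional.Properties
  using (filter-↭; ↭-singleton-inv; ↭-empty-inv; ∈-resp-↭; ↭-length)
open import Data.List.Relation.Unary.All as All using (All; []; _∷_)
import Data.List.Relation.Unary.All.Properties as All
open import Data.List.Relation.Unary.Any as Any using (Any; here; there)
import Data.List.Relation.Unary.Any.Properties as Any
open import Data.List.Relation.Unary.Linked using (Linked; linked?)
open import Data.Nat.Base hiding (_/_)
open import Data.Nat.Divisibility using (_∣_; _∣?_)
open import Data.Nat.GeneralisedArithmetic using (fold)
open import Data.Nat.ListAction using (sum; product)
open import Data.Nat.ListAction.Properties using (product≢0)
import Data.Nat.Properties as ℕ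
open import Data.Product.Base using (_×_; _,_; ∃; proj₁; proj₂)
open import Data.Rational.Base as ℚ using (ℚ; 0ℚ; 1ℚ; _/_)
import Data.Rational.Properties as ℚ
open import Data.Vec.Base as Vec using (Vec; []; _∷_; toList)
import Data.Vec.Properties as Vec
open import Function.Base using (_∘_; case_of_)
open import Relation.Binary.PropositionalEquality
open import Relation.Nullary using (Dec; yes; no; does; ¬_; ¬?; contradiction; _×-dec_; _→-dec_)
open import Relation.Nullary.Decidable using (dec-true; dec-false; map′)
open import Relation.Unary using (Decidable)

open import Data.List.Sort ℕ.≤-decTotalOrder using (sort; sort-↭)

private
  variable
    A : Set

-- The exponent list a₁ ∷ … ∷ aᵣ ∷ [] stands for the monomial
-- x₁^a₁ ⋯ xᵣ^aᵣ, so lists that differ by trailing zeros denote the same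
-- monomial.
Exponents : Set
Exponents = List ℕ

Series : Set
Series = Exponents → ℚ

∑ : List A → (A → ℚ) → ℚ
∑ xs f = foldr (λ x s → f x ℚ.+ s) 0ℚ xs

-- The coefficient of x^α in f g is the sum of f(β) g(γ) over all pairs of
-- exponent lists of the same length as α with β + γ = α.
conv : Series → Series → Series
conv f g []      = f [] ℚ.* g []
conv f g (a ∷ α) =
  ∑ (upTo (suc a)) λ i → conv (λ β → f (i ∷ β)) (λ γ → g (a ∸ i ∷ γ)) α

record IsSymmetricFunction (f : Series) : Set where
  field
    pad       : ∀ α → f (α ∷ʳ 0) ≡ f α
    symmetric : ∀ {α β} → α ↭ β → f α ≡ f β
    bounded   : ∃ λ d → ∀ α → d < sum α → f α ≡ 0ℚ

-- The ring Λ_ℚ: symmetric formal power series of bounded degree.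
record Λ : Set where
  constructor mkΛ
  field
    coeff               : Series
    isSymmetricFunction : IsSymmetricFunction coeff
  open IsSymmetricFunction isSymmetricFunction public

open Λ public using (coeff)

infix 4 _≈_
_≈_ : Λ → Λ → Set
f ≈ g = ∀ α → coeff f α ≡ coeff g α

∑-cong : ∀ (xs : List A) {f g : A → ℚ} → (∀ x → f x ≡ g x) → ∑ xs f ≡ ∑ xs g
∑-cong []       f≗g = refl
∑-cong (x ∷ xs) f≗g = cong₂ ℚ._+_ (f≗g x) (∑-cong xs f≗g)

∑-zero : ∀ (xs : List A) {f : A → ℚ} → (∀ {x} → x ∈ xs → f x ≡ 0ℚ) → ∑ xs f ≡ 0ℚ
∑-zero []       f≡0 = refl
∑-zero (x ∷ xs) f≡0 = cong₂ ℚ._+_ (f≡0 (here refl)) (∑-zero xs (f≡0 ∘ there))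

+-interchange : ∀ a b c d → (a ℚ.+ b) ℚ.+ (c ℚ.+ d) ≡ (a ℚ.+ c) ℚ.+ (b ℚ.+ d)
+-interchange a b c d = begin
  (a ℚ.+ b) ℚ.+ (c ℚ.+ d) ≡⟨ ℚ.+-assoc a b _ ⟩
  a ℚ.+ (b ℚ.+ (c ℚ.+ d)) ≡⟨ cong (a ℚ.+_) (ℚ.+-assoc b c d) ⟨
  a ℚ.+ ((b ℚ.+ c) ℚ.+ d) ≡⟨ cong (λ e → a ℚ.+ (e ℚ.+ d)) (ℚ.+-comm b c) ⟩
  a ℚ.+ ((c ℚ.+ b) ℚ.+ d) ≡⟨ cong (a ℚ.+_) (ℚ.+-assoc c b d) ⟩
  a ℚ.+ (c ℚ.+ (b ℚ.+ d)) ≡⟨ ℚ.+-assoc a c _ ⟨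
  (a ℚ.+ c) ℚ.+ (b ℚ.+ d) ∎
  where open ≡-Reasoning

∑-+ : ∀ (xs : List A) (f g : A → ℚ) → ∑ xs (λ x → f x ℚ.+ g x) ≡ ∑ xs f ℚ.+ ∑ xs g
∑-+ []       f g = refl
∑-+ (x ∷ xs) f g =
  trans (cong (f x ℚ.+ g x ℚ.+_) (∑-+ xs f g)) (+-interchange (f x) (g x) _ _)

∑-comm : ∀ {B : Set} (xs : List A) (ys : List B) (f : A → B → ℚ) →
         ∑ xs (λ x → ∑ ys (f x)) ≡ ∑ ys (λ y → ∑ xs (λ x → f x y))
∑-comm []       ys f = sym (∑-zero ys (λ _ → refl))
∑-comm (x ∷ xs) ys f =
  trans (cong (∑ ys (f x) ℚ.+_) (∑-comm xs ys f))
      (sym (∑-+ ys (f x) (λ y → ∑ xs (λ x′ → f x′ y))))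

conv-cong : ∀ α {f f′ g g′ : Series} → (∀ β → f β ≡ f′ β) → (∀ β → g β ≡ g′ β) →
            conv f g α ≡ conv f′ g′ α
conv-cong []      p q = cong₂ ℚ._*_ (p []) (q [])
conv-cong (a ∷ α) p q =
  ∑-cong (upTo (suc a)) λ i → conv-cong α (λ β → p (i ∷ β)) (λ β → q (a ∸ i ∷ β))

conv-pad : ∀ {f g} → (∀ α → f (α ∷ʳ 0) ≡ f α) → (∀ α → g (α ∷ʳ 0) ≡ g α) →
           ∀ α → conv f g (α ∷ʳ 0) ≡ conv f g α
conv-pad p q []      = trans (ℚ.+-identityʳ _) (cong₂ ℚ._*_ (p []) (q []))
conv-pad p q (a ∷ α) =
  ∑-cong (upTo (suc a)) λ i → conv-pad (λ β → p (i ∷ β)) (λ β → q (a ∸ i ∷ β)) α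

conv-↭ : ∀ {f g} → (∀ {α β} → α ↭ β → f α ≡ f β) → (∀ {α β} → α ↭ β → g α ≡ g β) →
         ∀ {α β} → α ↭ β → conv f g α ≡ conv f g β
conv-↭ p q ↭-refl        = refl
conv-↭ p q (prep a r)    =
  ∑-cong (upTo (suc a)) λ i → conv-↭ (λ s → p (prep i s)) (λ s → q (prep (a ∸ i) s)) r
conv-↭ {f} {g} p q {_ ∷ _ ∷ α} {_ ∷ _ ∷ β} (swap a b r) = trans
  (∑-comm (upTo (suc a)) (upTo (suc b)) λ i j →
    conv (λ γ → f (i ∷ j ∷ γ)) (λ γ → g (a ∸ i ∷ b ∸ j ∷ γ)) α)
  (∑-cong (upTo (suc b)) λ j → ∑-cong (upTo (suc a)) λ i → trans
    (conv-↭ (λ s → p (prep i (prep j s))) (λ s → q (prep (a ∸ i) (prep (b ∸ j) s))) r)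
    (conv-cong β (λ γ → p (swap i j ↭-refl)) (λ γ → q (swap (a ∸ i) (b ∸ j) ↭-refl))))
conv-↭ p q (↭-trans′ r s) = trans (conv-↭ p q r) (conv-↭ p q s)

conv-zero : ∀ α {f g} → (∀ β γ → sum β + sum γ ≡ sum α → f β ℚ.* g γ ≡ 0ℚ) →
            conv f g α ≡ 0ℚ
conv-zero []      h = h [] [] refl
conv-zero (a ∷ α) h = ∑-zero (upTo (suc a)) λ {i} i∈ → conv-zero α λ β γ eq →
  h (i ∷ β) (a ∸ i ∷ γ) (begin
    i + sum β + (a ∸ i + sum γ)   ≡⟨ +-inter i (sum β) (a ∸ i) (sum γ) ⟩
    i + (a ∸ i) + (sum β + sum γ) ≡⟨ cong₂ _+_ (ℕ.m+[n∸m]≡n (s≤s⁻¹ (∈-upTo⁻ i∈))) eq ⟩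
    a + sum α                     ∎)
  where
  open ≡-Reasoning
  open import Algebra.Properties.CommutativeSemigroup ℕ.+-commutativeSemigroup
    renaming (interchange to +-inter)

conv-bounded : ∀ {f g} → (∃ λ d → ∀ α → d < sum α → f α ≡ 0ℚ) →
               (∃ λ d → ∀ α → d < sum α → g α ≡ 0ℚ) →
               ∃ λ d → ∀ α → d < sum α → conv f g α ≡ 0ℚ
conv-bounded {f} {g} (d , p) (e , q) = d + e , λ α d+e<α → conv-zero α λ β γ eq →
  case d ℕ.<? sum β of λ where
    (yes d<β) → trans (cong (ℚ._* g γ) (p β d<β)) (ℚ.*-zeroˡ (g γ))
    (no  d≮β) → case e ℕ.<? sum γ of λ where
      (yes e<γ) → trans (cong (f β ℚ.*_) (q γ e<γ)) (ℚ.*-zeroʳ (f β))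
      (no  e≮γ) → contradiction
        (subst (_≤ d + e) eq (ℕ.+-mono-≤ (ℕ.≮⇒≥ d≮β) (ℕ.≮⇒≥ e≮γ)))
        (ℕ.<⇒≱ d+e<α)

nonzeroParts : List ℕ → List ℕ
nonzeroParts = filter (λ a → ¬? (a ℕ.≟ 0))

nonzeroParts-∷ʳ : ∀ α → nonzeroParts (α ∷ʳ 0) ≡ nonzeroParts α
nonzeroParts-∷ʳ α =
  trans (List.filter-++ (λ a → ¬? (a ℕ.≟ 0)) α (0 ∷ [])) (List.++-identityʳ _)

sum-nonzeroParts : ∀ α → sum (nonzeroParts α) ≡ sum α
sum-nonzeroParts []          = refl
sum-nonzeroParts (zero ∷ α)  = sum-nonzeroParts α
sum-nonzeroParts (suc a ∷ α) = cong (λ s → suc (a + s)) (sum-nonzeroParts α)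

hasParts? : (μ α : List ℕ) → Dec (nonzeroParts α ≡ μ)
hasParts? μ α = List.≡-dec ℕ._≟_ (nonzeroParts α) μ

single : ℚ → (μ : List ℕ) → (∀ {ν} → ν ↭ μ → ν ≡ μ) → Λ
single c μ inv = mkΛ f record
  { pad       = λ α → cong at (nonzeroParts-∷ʳ α)
  ; symmetric = λ r → at-↭ (filter-↭ (λ a → ¬? (a ℕ.≟ 0)) r)
  ; bounded   = sum μ , λ α μ<α → cong (λ b → if b then c else 0ℚ) (dec-false (hasParts? μ α)
      λ eq → ℕ.<-irrefl (trans (cong sum (sym eq)) (sum-nonzeroParts α)) μ<α)
  }
  where
  at : List ℕ → ℚ
  at ν = if does (List.≡-dec ℕ._≟_ ν μ) then c else 0ℚ
  f : Series
  f α = at (nonzeroParts α)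
  at-↭ : ∀ {ν ν′} → ν ↭ ν′ → at ν ≡ at ν′
  at-↭ {ν} {ν′} r with List.≡-dec ℕ._≟_ ν μ | List.≡-dec ℕ._≟_ ν′ μ
  ... | yes _    | yes _    = refl
  ... | no  _    | no  _    = refl
  ... | yes refl | no ν′≢μ  = contradiction (inv (↭-sym r)) ν′≢μ
  ... | no ν≢μ   | yes refl = contradiction (inv r) ν≢μ

const : ℚ → Λ
const c = single c [] ↭-empty-inv

-- The power sum p_k = Σᵢ xᵢᵏ for k ≥ 1: x^α occurs, with coefficient 1,
-- exactly when k is the only nonzero entry of α.  By this convention p 0 is
-- the zero series; shiftification maps it to 0, so it never matters.
p : ℕ → Λ
p k = single 1ℚ (k ∷ []) ↭-singleton-inv

infixl 6 _⊕_
infixl 7 _⊛_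
infixr 8 _•_

_⊕_ : Λ → Λ → Λ
f ⊕ g = mkΛ (λ α → coeff f α ℚ.+ coeff g α) record
  { pad       = λ α → cong₂ ℚ._+_ (Λ.pad f α) (Λ.pad g α)
  ; symmetric = λ r → cong₂ ℚ._+_ (Λ.symmetric f r) (Λ.symmetric g r)
  ; bounded   = let (d , p) = Λ.bounded f ; (e , q) = Λ.bounded g in d ⊔ e , λ α h →
      cong₂ ℚ._+_ (p α (ℕ.m⊔n<o⇒m<o d e h)) (q α (ℕ.m⊔n<o⇒n<o d e h))
  }

_⊛_ : Λ → Λ → Λ
f ⊛ g = mkΛ (conv (coeff f) (coeff g)) record
  { pad       = conv-pad (Λ.pad f) (Λ.pad g)
  ; symmetric = conv-↭ (Λ.symmetric f) (Λ.symmetric g)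
  ; bounded   = conv-bounded (Λ.bounded f) (Λ.bounded g)
  }

_•_ : ℚ → Λ → Λ
c • f = mkΛ (λ α → c ℚ.* coeff f α) record
  { pad       = λ α → cong (c ℚ.*_) (Λ.pad f α)
  ; symmetric = λ r → cong (c ℚ.*_) (Λ.symmetric f r)
  ; bounded   = let (d , p) = Λ.bounded f in d , λ α h →
      trans (cong (c ℚ.*_) (p α h)) (ℚ.*-zeroʳ c)
  }

∑Λ : List A → (A → Λ) → Λ
∑Λ xs f = foldr (λ x s → f x ⊕ s) (const 0ℚ) xs

p⟨_⟩ : List ℕ → Λ
p⟨ μ ⟩ = foldr (λ k f → p k ⊛ f) (const 1ℚ) μ

-- Polynomial expressions over ℚ in indeterminates X₁, X₂, …
data Poly : Set where
  con       : ℚ → Poly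
  X         : ℕ → Poly
  _:+_ _:*_ : Poly → Poly → Poly

⟦_⟧ : Poly → (ℕ → Λ) → Λ
⟦ con c  ⟧ ρ = const c
⟦ X k    ⟧ ρ = ρ k
⟦ P :+ Q ⟧ ρ = ⟦ P ⟧ ρ ⊕ ⟦ Q ⟧ ρ
⟦ P :* Q ⟧ ρ = ⟦ P ⟧ ρ ⊛ ⟦ Q ⟧ ρ

-- The image of p_k under shiftification: 2 p_k for k odd, 0 for k even.
shiftedPowerSum : ℕ → Λ
shiftedPowerSum k = if does (2 ∣? k) then const 0ℚ else (+ 2 / 1) • p k

-- f [x/x]≈ g says that g is f(x/x): write f as a polynomial in the power
-- sums, then substitute.  The power sums generate Λ_ℚ and are algebraically
-- independent, so this relation is the graph of a map Λ_ℚ → Λ_ℚ.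
infix 4 _[x/x]≈_
_[x/x]≈_ : Λ → Λ → Set
f [x/x]≈ g = ∃ λ P → f ≈ ⟦ P ⟧ p × g ≈ ⟦ P ⟧ shiftedPowerSum

-- All words of length n in the letters 1, …, k.
words : (k n : ℕ) → List (Vec ℕ n)
words k zero    = [] ∷ []
words k (suc n) = cartesianProductWith _∷_ (map suc (upTo k)) (words k n)

∈-words : ∀ {k n} (v : Vec ℕ n) →
          (∀ {a} → a ∈ toList v → 1 ≤ a × a ≤ k) → v ∈ words k n
∈-words []          h = here refl
∈-words (zero  ∷ v) h = contradiction (proj₁ (h (here refl))) λ ()
∈-words (suc a ∷ v) h = ∈-cartesianProductWith⁺ _∷_
  (∈-map⁺ suc (∈-upTo⁺ (proj₂ (h (here refl))))) (∈-words v (h ∘ there))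

record IsPartitionOf (n : ℕ) (μ : List ℕ) : Set where
  constructor isPartitionOf
  field
    decreasing : Linked _≥_ μ
    positive   : All (1 ≤_) μ
    total      : sum μ ≡ n

isPartitionOf? : ∀ n → Decidable (IsPartitionOf n)
isPartitionOf? n μ = map′
  (λ (d , p , t) → isPartitionOf d p t)
  (λ (isPartitionOf d p t) → d , p , t)
  (linked? ℕ._≥?_ μ ×-dec All.all? (1 ℕ.≤?_) μ ×-dec sum μ ℕ.≟ n)

partitions : ℕ → List (List ℕ)
partitions n =
  filter (isPartitionOf? n) (concatMap (λ l → map toList (words n l)) (upTo (suc n)))

∈-partitions : ∀ {n μ} → IsPartitionOf n μ → μ ∈ partitions n
∈-partitions {n} {μ} h@(isPartitionOf _ pos refl) =
  ∈-filter⁺ (isPartitionOf? n)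
    (∈-concatMap⁺ candidates
      (Any.map {P = length μ ≡_} (λ { refl → μ∈candidates })
               (∈-upTo⁺ (s≤s (length≤sum pos)))))
    h
  where
  candidates : ℕ → List (List ℕ)
  candidates l = map toList (words n l)
  length≤sum : ∀ {ν} → All (1 ≤_) ν → length ν ≤ sum ν
  length≤sum []       = z≤n
  length≤sum (h ∷ hs) = ℕ.+-mono-≤ h (length≤sum hs)
  ≤sum : ∀ {a ν} → a ∈ ν → a ≤ sum ν
  ≤sum (here refl) = ℕ.m≤m+n _ _
  ≤sum {ν = b ∷ _} (there a∈) = ℕ.≤-trans (≤sum a∈) (ℕ.m≤n+m _ b)
  μ∈candidates : μ ∈ candidates (length μ)
  μ∈candidates = subst (_∈ candidates (length μ)) (Vec.toList∘fromList μ)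
    (∈-map⁺ toList (∈-words (Vec.fromList μ) λ {a} a∈ →
      let a∈μ = subst (a ∈_) (Vec.toList∘fromList μ) a∈ in
      All.lookup pos a∈μ , ≤sum a∈μ))

Odd : ℕ → Set
Odd k = ¬ 2 ∣ k

oddPartitions : ℕ → List (List ℕ)
oddPartitions n = filter (All.all? (λ k → ¬? (2 ∣? k))) (partitions n)

∈-oddPartitions : ∀ {n μ} → IsPartitionOf n μ → All Odd μ → μ ∈ oddPartitions n
∈-oddPartitions h odd = ∈-filter⁺ (All.all? (λ k → ¬? (2 ∣? k))) (∈-partitions h) odd

multiplicity : ℕ → List ℕ → ℕ
multiplicity i μ = length (filter (i ℕ.≟_) μ)

-- The product over all i ≥ 1 may stop at sum μ, which bounds every part.
z : List ℕ → ℕ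
z μ = product (map (λ i → i ^ multiplicity i μ * multiplicity i μ !)
                   (map suc (upTo (sum μ))))

z≢0 : ∀ μ → NonZero (z μ)
z≢0 μ = product≢0 (All.map⁺ (All.map⁺ (All.universal factor (upTo (sum μ)))))
  where
  factor : ∀ i → NonZero (suc i ^ multiplicity (suc i) μ * multiplicity (suc i) μ !)
  factor i = let m = multiplicity (suc i) μ in
    ℕ.m*n≢0 (suc i ^ m) (m !) {{ℕ.m^n≢0 (suc i) m}} {{m ℕ.!≢0}}

z⁻¹ : List ℕ → ℚ
z⁻¹ μ = _/_ (+ 1) (z μ) {{z≢0 μ}}

-- Every permutation σ of Fin (suc n) is, for exactly one j and one π, the
-- permutation lift₀ π followed by the transposition (0 j); here j = σ(0).
permutations : ∀ n → List (Permutation′ n)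
permutations zero    = Perm.id ∷ []
permutations (suc n) =
  cartesianProductWith (λ j π → lift₀ π ∘ₚ transpose Fin.zero j)
    (allFin (suc n)) (permutations n)

∈-permutations : ∀ {n} (σ : Permutation′ n) → Any (σ Perm.≈_) (permutations n)
∈-permutations {zero}  σ = here λ ()
∈-permutations {suc n} σ =
  Any.cartesianProductWith⁺ (λ j π → lift₀ π ∘ₚ transpose Fin.zero j) combine
    (∈-allFin j) (∈-permutations (remove Fin.zero σ′))
  where
  open ≡-Reasoning
  j  = σ ⟨$⟩ʳ Fin.zero
  σ′ = σ ∘ₚ transpose j Fin.zero
  σ′0≡0 : σ′ ⟨$⟩ʳ Fin.zero ≡ Fin.zero
  σ′0≡0 rewrite dec-true (j Fin.≟ j) refl = refl
  combine : ∀ {k π} → j ≡ k → remove Fin.zero σ′ Perm.≈ π →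
            σ Perm.≈ (lift₀ π ∘ₚ transpose Fin.zero k)
  combine {π = π} refl τ≈π i = begin
    σ ⟨$⟩ʳ i
      ≡⟨ PC.transpose-inverse Fin.zero j ⟨
    PC.transpose Fin.zero j (σ′ ⟨$⟩ʳ i)
      ≡⟨ cong (PC.transpose Fin.zero j)
           (trans (sym (Perm.lift₀-remove σ′ σ′0≡0 i))
                  (Perm.lift₀-cong (remove Fin.zero σ′) π τ≈π i)) ⟩
    PC.transpose Fin.zero j (lift₀ π ⟨$⟩ʳ i) ∎

-- k = wʲ(i) for some j; exponents j < n suffice, as cycles have length ≤ n.
SameCycle : ∀ {n} → Permutation′ n → Fin n → Fin n → Set
SameCycle {n} w i k = ∃ λ (j : Fin n) → fold i (w ⟨$⟩ʳ_) (toℕ j) ≡ k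

sameCycle? : ∀ {n} (w : Permutation′ n) (i : Fin n) → Decidable (SameCycle w i)
sameCycle? w i k = Fin.any? (λ j → fold i (w ⟨$⟩ʳ_) (toℕ j) Fin.≟ k)

cycleLength : ∀ {n} → Permutation′ n → Fin n → ℕ
cycleLength w i = length (filter (sameCycle? w i) (allFin _))

IsLeast : ∀ {n} → Permutation′ n → Fin n → Set
IsLeast w i = ∀ k → SameCycle w i k → i Fin.≤ k

isLeast? : ∀ {n} (w : Permutation′ n) → Decidable (IsLeast w)
isLeast? w i = Fin.all? λ k → sameCycle? w i k →-dec (i Fin.≤? k)

-- The lengths of the cycles of w, one for each cycle.  They are left
-- unsorted, since p⟨_⟩ does not depend on the order.
cycleType : ∀ {n} → Permutation′ n → List ℕ
cycleType w = map (cycleLength w) (filter (isLeast? w) (allFin _))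

-- The Frobenius characteristic (1/n!) Σ_{w ∈ Sₙ} χ(w) p_{cycle type of w}.
frobenius : ∀ n → (Permutation′ n → ℚ) → Λ
frobenius n χ =
  (_/_ (+ 1) (n !) {{ℕ._!≢0 n}}) • ∑Λ (permutations n) λ w → χ w • p⟨ cycleType w ⟩

record IsParkingFunction {n} (a : Vec ℕ n) : Set where
  constructor isParkingFunction
  rearrangement : List ℕ
  rearrangement = sort (toList a)
  field
    positive : All (1 ≤_) (toList a)
    -- bᵢ ≤ i, with positions counted from 0.
    parked   : ∀ i → List.lookup rearrangement i ≤ suc (toℕ i)

isParkingFunction? : ∀ {n} → Decidable (IsParkingFunction {n})
isParkingFunction? a = map′
  (λ (p , q) → isParkingFunction p q)
  (λ (isParkingFunction p q) → p , q)
  (All.all? (1 ℕ.≤?_) (toList a) ×-dec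
   Fin.all? (λ i → List.lookup (sort (toList a)) i ℕ.≤? suc (toℕ i)))

parkingFunctions : ∀ n → List (Vec ℕ n)
parkingFunctions n = filter isParkingFunction? (words n n)

∈-parkingFunctions : ∀ {n} {a : Vec ℕ n} → IsParkingFunction a → a ∈ parkingFunctions n
∈-parkingFunctions {n} {a} h@(isParkingFunction pos parked) =
  ∈-filter⁺ isParkingFunction? (∈-words a λ x∈a → All.lookup pos x∈a , bound x∈a) h
  where
  length-b : length (sort (toList a)) ≡ n
  length-b = trans (↭-length (sort-↭ (toList a))) (Vec.length-toList a)
  bound : ∀ {x} → x ∈ toList a → x ≤ n
  bound {x} x∈a = subst (x ≤_) length-b (ℕ.≤-trans
    (subst (_≤ suc (toℕ i)) (sym (Any.lookup-index x∈b)) (parked i)) (Fin.toℕ<n i))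
    where
    x∈b = ∈-resp-↭ (↭-sym (sort-↭ (toList a))) x∈a
    i   = Any.index x∈b

infixr 8 _·_
_·_ : ∀ {n} → Permutation′ n → Vec ℕ n → Vec ℕ n
w · a = Vec.tabulate λ i → Vec.lookup a (w ⟨$⟩ˡ i)

-- The matrix of w in the permutation representation whose basis is the set
-- of parking functions.
matrix : ∀ {n} → Permutation′ n → Vec ℕ n → Vec ℕ n → ℚ
matrix w a b = if does (Vec.≡-dec ℕ._≟_ a (w · b)) then 1ℚ else 0ℚ

parkingCharacter : ∀ n → Permutation′ n → ℚ
parkingCharacter n w = ∑ (parkingFunctions n) λ a → matrix w a a

PF : ℕ → Λ
PF n = frobenius n (parkingCharacter n)

{-# OPTIONS --safe #-}
module Submission where

-- Insert a new point into a permutation, as a fixed point or into an existing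
-- cycle.  Following the cycle type through this step yields the recursion
-- n Eₙ(F) = Σₖ Eₙ₋ₖ(F(k ∷ _)) for averages over cycle types (Newton's identity
-- n hₙ = Σₖ pₖ hₙ₋ₖ), so cycle type λ has frequency 1/z_λ.  The same step shows
-- that a permutation with ℓ cycles fixes (n+1)^ℓ words of length n in n+1
-- letters.  By the cycle lemma exactly one of the n+1 cyclic rotations of the
-- alphabet turns a given word into a parking function, and these rotations
-- commute with permuting positions; so (n+1)^(ℓ-1) of the fixed words are
-- parking functions.  Shiftification multiplies p_λ by 2^ℓ if all parts of λ
-- are odd and kills it otherwise.

open import Defs
open import Data.Bool.Base using (if_then_else_; true; false)
open import Data.Fin.Base as Fin using (Fin; toℕ; fromℕ<)
open import Data.Fin.Permutation as Perm
  using (Permutation′; _⟨$⟩ʳ_; _⟨$⟩ˡ_; _∘ₚ_; lift₀; transpose)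
import Data.Fin.Properties as Fin
open import Data.Integer.Base as ℤ using (+_)
import Data.Integer.Properties as ℤ
open import Data.List.Base as List
  using (List; []; _∷_; _++_; _∷ʳ_; length; map; foldr; filter; upTo; allFin; cartesianProductWith)
open import Data.List.Membership.Propositional using (_∈_)
open import Data.List.Membership.Propositional.Properties
  using (∈-upTo⁺; ∈-upTo⁻; ∈-∃++; ∈-map⁻; ∈-filter⁺; ∈-filter⁻; ∈-allFin; ∈-lookup;
         ∈-cartesianProductWith⁻)
import Data.List.Properties as List
open import Data.List.Relation.Binary.Disjoint.Propositional using (Disjoint)
open import Data.List.Relation.Binary.Permutation.Propositional
  using (_↭_; prep; swap; ↭-sym; ↭-trans; ↭-reflexive; ↭⇒↭ₛ)
open _↭_ using () renaming (refl to ↭-refl; trans to ↭-trans′)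
open import Data.List.Relation.Binary.Permutation.Propositional.Properties
  using (filter-↭; ↭-length; ∈-resp-↭; All-resp-↭; drop-∷; shift; ↭-empty-inv)
open import Data.List.Relation.Binary.Pointwise using (Pointwise-≡⇒≡)
open import Data.List.Relation.Unary.All as All using (All; []; _∷_)
import Data.List.Relation.Unary.All.Properties as All
open import Data.List.Relation.Unary.AllPairs as AllPairs using ([]; _∷_)
import Data.List.Relation.Unary.AllPairs.Properties as AllPairs
open import Data.List.Relation.Unary.Any using (here; there)
open import Data.List.Relation.Unary.Linked as Linked using (Linked)
import Data.List.Relation.Unary.Linked.Properties as Linked
import Data.List.Relation.Unary.Sorted.TotalOrder.Properties as Sorted
open import Data.List.Relation.Unary.Unique.Propositional using (Unique)
import Data.List.Relation.Unary.Unique.Propositional.Properties as Unique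
open import Data.Nat.Base using (ℕ; zero; suc; _+_; _*_; _∸_; _^_; _!; _≤_; _<_; _≥_; z≤n; s≤s; s≤s⁻¹; NonZero)
open import Data.Nat.Divisibility using (_∣_; _∣?_)
open import Data.Nat.GeneralisedArithmetic using (fold; fold-+)
open import Data.Nat.Induction using (<-rec)
open import Data.Nat.ListAction using (sum; product)
open import Data.Nat.ListAction.Properties using (sum-↭; product-++)
import Data.Nat.Properties as ℕ
open import Data.Product.Base using (_×_; _,_; ∃; proj₁; proj₂)
open import Data.Rational.Base as ℚ using (ℚ; 0ℚ; 1ℚ; _/_)
import Data.Rational.Properties as ℚ
open import Data.Rational.Solver using (module +-*-Solver)
open import Data.Rational.Unnormalised.Base as ℚᵘ using (mkℚᵘ; *≡*)
import Data.Rational.Unnormalised.Properties as ℚᵘ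
open import Data.Sum.Base using (inj₁; inj₂)
open import Data.Vec.Base as Vec using (Vec; []; _∷_; toList; lookup)
import Data.Vec.Properties as Vec
open import Function.Base using (_∘_; id; case_of_)
import Relation.Binary.Construct.Flip.EqAndOrd as Flip
open import Relation.Binary.Definitions using (tri<; tri≈; tri>)
open import Relation.Binary.PropositionalEquality
open import Relation.Nullary using (Dec; yes; no; does; ¬_; ¬?; contradiction; _×-dec_; _→-dec_)
open import Relation.Nullary.Decidable using (dec-true; dec-false; map′)
open import Relation.Unary using (Decidable)

open import Algebra.Properties.CommutativeSemigroup ℕ.+-commutativeSemigroup using (xy∙z≈xz∙y)
open import Algebra.Properties.CommutativeSemigroup ℕ.*-commutativeSemigroup
  using () renaming (interchange to *-interchange)
open import Data.List.Membership.DecPropositional ℕ._≟_ using (_∈?_)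
open import Data.List.Sort ℕ.≤-decTotalOrder using (sort; sort-↭; sort-↗)
import Data.List.Sort (Flip.decTotalOrder ℕ.≤-decTotalOrder) as Decreasing

open ≡-Reasoning
open +-*-Solver using (solve; _:=_) renaming (_:+_ to _⊞_; _:*_ to _⊠_)

-- Conjugacy classes are never counted directly. The average over the symmetric group of a function
-- `F` of the cycle type is treated as a linear functional of `F`, and its recursion is proved for
-- all `F` at once: the induction step applies the hypothesis to `augment F`, so a single fixed `F`
-- would not do. Evaluating the functional at indicator functions then gives the frequencies.
-- `cycleType` is an unsorted list, so `F` has to be invariant under rearrangement, with partitions
-- as representatives.
--
-- Equality in Λ is equality of all coefficients. For each exponent list the theorem is therefore
-- one identity of rational sums, where `F` is a power of n + 1 times a coefficient of a product of
-- shifted power sums.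
--
-- The cycle lemma is proved with paths. Over a full turn of n + 1 steps the path of a word gains n
-- letters and drops by 1 in total, so a comparison across the turn trades a strict for a weak
-- inequality. The first among the lowest points thus moves by exactly one step when the alphabet is
-- rotated, even if several points are equally low.

private
  variable
    A B : Set
    P Q : Set
    n ℓ : ℕ

-- Sums and indicators

ι : ℕ → ℚ
ι n = + n / 1

-- `_/_` divides by a gcd, so this does not hold by computation. Among unnormalised rationals both
-- sides are fractions with denominator 1.
ι-+ : ∀ m n → ι (m + n) ≡ ι m ℚ.+ ι n
ι-+ m n = ℚ.toℚᵘ-injective (begin-equality
  ℚ.toℚᵘ (ι (m + n))                 ≃⟨ ℚ.toℚᵘ-fromℚᵘ (mkℚᵘ (+ (m + n)) 0) ⟩
  mkℚᵘ (+ (m + n)) 0                 ≃⟨ *≡* (cong (ℤ._* + 1) (sym (cong₂ ℤ._+_ (ℤ.*-identityʳ (+ m)) (ℤ.*-identityʳ (+ n))))) ⟩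
  mkℚᵘ (+ m) 0 ℚᵘ.+ mkℚᵘ (+ n) 0     ≃⟨ ℚᵘ.+-cong (ℚ.toℚᵘ-fromℚᵘ (mkℚᵘ (+ m) 0)) (ℚ.toℚᵘ-fromℚᵘ (mkℚᵘ (+ n) 0)) ⟨
  ℚ.toℚᵘ (ι m) ℚᵘ.+ ℚ.toℚᵘ (ι n)     ≃⟨ ℚ.toℚᵘ-homo-+ (ι m) (ι n) ⟨
  ℚ.toℚᵘ (ι m ℚ.+ ι n)               ∎′)
  where open ℚᵘ.≤-Reasoning renaming (_∎ to _∎′)

ι-* : ∀ m n → ι (m * n) ≡ ι m ℚ.* ι n
ι-* m n = ℚ.toℚᵘ-injective (begin-equality
  ℚ.toℚᵘ (ι (m * n))                 ≃⟨ ℚ.toℚᵘ-fromℚᵘ (mkℚᵘ (+ (m * n)) 0) ⟩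
  mkℚᵘ (+ (m * n)) 0                 ≃⟨ *≡* (cong (ℤ._* + 1) (ℤ.pos-* m n)) ⟩
  mkℚᵘ (+ m) 0 ℚᵘ.* mkℚᵘ (+ n) 0     ≃⟨ ℚᵘ.*-cong (ℚ.toℚᵘ-fromℚᵘ (mkℚᵘ (+ m) 0)) (ℚ.toℚᵘ-fromℚᵘ (mkℚᵘ (+ n) 0)) ⟨
  ℚ.toℚᵘ (ι m) ℚᵘ.* ℚ.toℚᵘ (ι n)     ≃⟨ ℚ.toℚᵘ-homo-* (ι m) (ι n) ⟨
  ℚ.toℚᵘ (ι m ℚ.* ι n)               ∎′)
  where open ℚᵘ.≤-Reasoning renaming (_∎ to _∎′)

inv : (n : ℕ) .{{_ : NonZero n}} → ℚ
inv n = + 1 / n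

ι*inv : ∀ n .{{_ : NonZero n}} → ι n ℚ.* inv n ≡ 1ℚ
ι*inv n@(suc m) = ℚ.toℚᵘ-injective (begin-equality
  ℚ.toℚᵘ (ι n ℚ.* inv n)              ≃⟨ ℚ.toℚᵘ-homo-* (ι n) (inv n) ⟩
  ℚ.toℚᵘ (ι n) ℚᵘ.* ℚ.toℚᵘ (inv n)    ≃⟨ ℚᵘ.*-cong (ℚ.toℚᵘ-fromℚᵘ (mkℚᵘ (+ n) 0)) (ℚ.toℚᵘ-fromℚᵘ (mkℚᵘ (+ 1) m)) ⟩
  mkℚᵘ (+ n) 0 ℚᵘ.* mkℚᵘ (+ 1) m      ≃⟨ *≡* (cong +_ (trans (ℕ.*-comm (n * 1) 1) (cong (1 *_) (ℕ.*-comm n 1)))) ⟩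
  ℚ.toℚᵘ 1ℚ                           ∎′)
  where
  open ℚᵘ.≤-Reasoning renaming (_∎ to _∎′)

ι-cancelˡ : ∀ n .{{_ : NonZero n}} {x y} → ι n ℚ.* x ≡ ι n ℚ.* y → x ≡ y
ι-cancelˡ n {x} {y} eq = begin
  x                           ≡⟨ undo x ⟨
  inv n ℚ.* (ι n ℚ.* x)       ≡⟨ cong (inv n ℚ.*_) eq ⟩
  inv n ℚ.* (ι n ℚ.* y)       ≡⟨ undo y ⟩
  y                           ∎
  where
  undo : ∀ x → inv n ℚ.* (ι n ℚ.* x) ≡ x
  undo x = begin
    inv n ℚ.* (ι n ℚ.* x)     ≡⟨ solve 3 (λ a b c → a ⊠ (b ⊠ c) := (b ⊠ a) ⊠ c) refl (inv n) (ι n) x ⟩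
    ι n ℚ.* inv n ℚ.* x       ≡⟨ cong (ℚ._* x) (ι*inv n) ⟩
    1ℚ ℚ.* x                  ≡⟨ ℚ.*-identityˡ x ⟩
    x                         ∎

inv-unique : ∀ m .{{_ : NonZero m}} {x} → ι m ℚ.* x ≡ 1ℚ → x ≡ inv m
inv-unique m eq = ι-cancelˡ m (trans eq (sym (ι*inv m)))

-- The product is a variable `o` of its own, so that its form and its `NonZero` instance can be
-- those of a factorial.
inv-* : ∀ m n o .{{_ : NonZero m}} .{{_ : NonZero n}} .{{_ : NonZero o}} →
        o ≡ m * n → inv o ≡ inv m ℚ.* inv n
inv-* m n o o≡mn = sym (inv-unique o (begin
  ι o ℚ.* (inv m ℚ.* inv n)          ≡⟨ cong (λ o → ι o ℚ.* (inv m ℚ.* inv n)) o≡mn ⟩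
  ι (m * n) ℚ.* (inv m ℚ.* inv n)    ≡⟨ cong (ℚ._* (inv m ℚ.* inv n)) (ι-* m n) ⟩
  ι m ℚ.* ι n ℚ.* (inv m ℚ.* inv n)
    ≡⟨ solve 4 (λ a b c d → (a ⊠ b) ⊠ (c ⊠ d) := (a ⊠ c) ⊠ (b ⊠ d)) refl (ι m) (ι n) (inv m) (inv n) ⟩
  (ι m ℚ.* inv m) ℚ.* (ι n ℚ.* inv n) ≡⟨ cong₂ ℚ._*_ (ι*inv m) (ι*inv n) ⟩
  1ℚ                                 ∎))

-- Same shape as the entries of `matrix`; hence the trace `parkingCharacter` is by definition a sum
-- of these indicators.
𝟙 : Dec P → ℚ
𝟙 d = if does d then 1ℚ else 0ℚ

𝟙-yes : (d : Dec P) → P → 𝟙 d ≡ 1ℚ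
𝟙-yes d p rewrite dec-true d p = refl

𝟙-no : (d : Dec P) → ¬ P → 𝟙 d ≡ 0ℚ
𝟙-no d ¬p rewrite dec-false d ¬p = refl

𝟙-cong : (d : Dec P) (e : Dec Q) → (P → Q) → (Q → P) → 𝟙 d ≡ 𝟙 e
𝟙-cong (yes p) e f g = sym (𝟙-yes e (f p))
𝟙-cong (no ¬p) e f g = sym (𝟙-no e (¬p ∘ g))

𝟙-× : (d : Dec P) (e : Dec Q) → 𝟙 (d ×-dec e) ≡ 𝟙 d ℚ.* 𝟙 e
𝟙-× (yes _) (yes _) = refl
𝟙-× (yes _) (no _)  = refl
𝟙-× (no _)  e       = sym (ℚ.*-zeroˡ (𝟙 e))

∑-cong-∈ : ∀ (xs : List A) {f g : A → ℚ} → (∀ {x} → x ∈ xs → f x ≡ g x) → ∑ xs f ≡ ∑ xs g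
∑-cong-∈ []       f≗g = refl
∑-cong-∈ (x ∷ xs) f≗g = cong₂ ℚ._+_ (f≗g (here refl)) (∑-cong-∈ xs (f≗g ∘ there))

∑-*ˡ : ∀ (xs : List A) c (f : A → ℚ) → ∑ xs (λ x → c ℚ.* f x) ≡ c ℚ.* ∑ xs f
∑-*ˡ []       c f = sym (ℚ.*-zeroʳ c)
∑-*ˡ (x ∷ xs) c f =
  trans (cong (c ℚ.* f x ℚ.+_) (∑-*ˡ xs c f)) (sym (ℚ.*-distribˡ-+ c (f x) _))

∑-*ʳ : ∀ (xs : List A) c (f : A → ℚ) → ∑ xs (λ x → f x ℚ.* c) ≡ ∑ xs f ℚ.* c
∑-*ʳ xs c f = begin
  ∑ xs (λ x → f x ℚ.* c) ≡⟨ ∑-cong xs (λ x → ℚ.*-comm (f x) c) ⟩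
  ∑ xs (λ x → c ℚ.* f x) ≡⟨ ∑-*ˡ xs c f ⟩
  c ℚ.* ∑ xs f           ≡⟨ ℚ.*-comm c _ ⟩
  ∑ xs f ℚ.* c           ∎

∑-++ : ∀ (xs ys : List A) (f : A → ℚ) → ∑ (xs ++ ys) f ≡ ∑ xs f ℚ.+ ∑ ys f
∑-++ []       ys f = sym (ℚ.+-identityˡ _)
∑-++ (x ∷ xs) ys f = trans (cong (f x ℚ.+_) (∑-++ xs ys f)) (sym (ℚ.+-assoc (f x) _ _))

∑-map : ∀ (g : A → B) xs (f : B → ℚ) → ∑ (map g xs) f ≡ ∑ xs (f ∘ g)
∑-map g []       f = refl
∑-map g (x ∷ xs) f = cong (f (g x) ℚ.+_) (∑-map g xs f)

∑-cartesianProductWith : ∀ {C : Set} (g : A → B → C) xs ys (f : C → ℚ) →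
  ∑ (cartesianProductWith g xs ys) f ≡ ∑ xs (λ x → ∑ ys (λ y → f (g x y)))
∑-cartesianProductWith g []       ys f = refl
∑-cartesianProductWith g (x ∷ xs) ys f = trans (∑-++ (map (g x) ys) _ f)
  (cong₂ ℚ._+_ (∑-map (g x) ys f) (∑-cartesianProductWith g xs ys f))

∑-filter : ∀ {R : A → Set} (R? : Decidable R) xs (f : A → ℚ) →
           ∑ (filter R? xs) f ≡ ∑ xs (λ x → 𝟙 (R? x) ℚ.* f x)
∑-filter R? []       f = refl
∑-filter R? (x ∷ xs) f with R? x
... | yes _ = cong₂ ℚ._+_ (sym (ℚ.*-identityˡ (f x))) (∑-filter R? xs f)
... | no  _ = begin
  ∑ (filter R? xs) f                                     ≡⟨ ∑-filter R? xs f ⟩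
  ∑ xs (λ x → 𝟙 (R? x) ℚ.* f x)                          ≡⟨ ℚ.+-identityˡ _ ⟨
  0ℚ ℚ.+ ∑ xs (λ x → 𝟙 (R? x) ℚ.* f x)                   ≡⟨ cong (ℚ._+ _) (ℚ.*-zeroˡ (f x)) ⟨
  0ℚ ℚ.* f x ℚ.+ ∑ xs (λ x → 𝟙 (R? x) ℚ.* f x)           ∎

∑-filter-support : ∀ {R : A → Set} (R? : Decidable R) xs (f : A → ℚ) →
                   (∀ {x} → x ∈ xs → ¬ R x → f x ≡ 0ℚ) → ∑ (filter R? xs) f ≡ ∑ xs f
∑-filter-support R? xs f f≡0 = trans (∑-filter R? xs f) (∑-cong-∈ xs λ {x} x∈ → drop x∈ (R? x))
  where
  drop : ∀ {x} → x ∈ xs → (d : Dec _) → 𝟙 d ℚ.* f x ≡ f x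
  drop {x} x∈ (yes _) = ℚ.*-identityˡ (f x)
  drop {x} x∈ (no ¬r) = trans (ℚ.*-zeroˡ (f x)) (sym (f≡0 x∈ ¬r))

ι-length-filter : ∀ {R : A → Set} (R? : Decidable R) xs →
                  ι (length (filter R? xs)) ≡ ∑ xs (λ x → 𝟙 (R? x))
ι-length-filter R? []       = refl
ι-length-filter R? (x ∷ xs) with R? x
... | yes _ = trans (ι-+ 1 (length (filter R? xs))) (cong (1ℚ ℚ.+_) (ι-length-filter R? xs))
... | no  _ = trans (ι-length-filter R? xs) (sym (ℚ.+-identityˡ _))

∑-unique : ∀ {xs : List A} {x} {f : A → ℚ} → Unique xs → x ∈ xs →
           (∀ {y} → y ∈ xs → y ≢ x → f y ≡ 0ℚ) → ∑ xs f ≡ f x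
∑-unique {xs = x ∷ xs} {f = f} (x∉ ∷ _) (here refl) f≡0 = trans
  (cong (f x ℚ.+_) (∑-zero xs λ y∈ → f≡0 (there y∈) (All.lookup x∉ y∈ ∘ sym)))
  (ℚ.+-identityʳ (f x))
∑-unique {xs = z ∷ xs} (z∉ ∷ u) (there x∈) f≡0 = trans
  (cong₂ ℚ._+_ (f≡0 (here refl) (All.lookup z∉ x∈)) (∑-unique u x∈ (f≡0 ∘ there)))
  (ℚ.+-identityˡ _)

∑-upTo-head : ∀ n (f : ℕ → ℚ) → ∑ (upTo (suc n)) f ≡ f 0 ℚ.+ ∑ (upTo n) (f ∘ suc)
∑-upTo-head n f = cong (f 0 ℚ.+_)
  (trans (cong (λ xs → ∑ xs f) (sym (List.map-upTo suc n))) (∑-map suc (upTo n) f))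

∑-upTo-last : ∀ n (f : ℕ → ℚ) → ∑ (upTo (suc n)) f ≡ ∑ (upTo n) f ℚ.+ f n
∑-upTo-last n f = begin
  ∑ (upTo (suc n)) f               ≡⟨ cong (λ xs → ∑ xs f) (List.upTo-∷ʳ n) ⟨
  ∑ (upTo n ∷ʳ n) f                ≡⟨ ∑-++ (upTo n) (n ∷ []) f ⟩
  ∑ (upTo n) f ℚ.+ (f n ℚ.+ 0ℚ)    ≡⟨ cong (∑ (upTo n) f ℚ.+_) (ℚ.+-identityʳ (f n)) ⟩
  ∑ (upTo n) f ℚ.+ f n             ∎

∑-upTo-cong : ∀ n {f g : ℕ → ℚ} → (∀ i → i < n → f i ≡ g i) → ∑ (upTo n) f ≡ ∑ (upTo n) g
∑-upTo-cong n f≗g = ∑-cong-∈ (upTo n) λ i∈ → f≗g _ (∈-upTo⁻ i∈)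

allFin-suc : ∀ n → allFin (suc n) ≡ Fin.zero ∷ map Fin.suc (allFin n)
allFin-suc n = cong (Fin.zero ∷_) (sym (List.map-tabulate id Fin.suc))

∑-allFin-suc : ∀ n (f : Fin (suc n) → ℚ) →
               ∑ (allFin (suc n)) f ≡ f Fin.zero ℚ.+ ∑ (allFin n) (f ∘ Fin.suc)
∑-allFin-suc n f = trans (cong (λ xs → ∑ xs f) (allFin-suc n))
  (cong (f Fin.zero ℚ.+_) (∑-map Fin.suc (allFin n) f))

-- The algebra of symmetric functions

∑-upTo-reverse : ∀ a (f : ℕ → ℚ) → ∑ (upTo (suc a)) (λ i → f (a ∸ i)) ≡ ∑ (upTo (suc a)) f
∑-upTo-reverse zero    f = refl
∑-upTo-reverse (suc a) f = begin
  ∑ (upTo (2 + a)) (λ i → f (suc a ∸ i))               ≡⟨ ∑-upTo-head (suc a) (λ i → f (suc a ∸ i)) ⟩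
  f (suc a) ℚ.+ ∑ (upTo (suc a)) (λ i → f (a ∸ i))     ≡⟨ cong (f (suc a) ℚ.+_) (∑-upTo-reverse a f) ⟩
  f (suc a) ℚ.+ ∑ (upTo (suc a)) f                     ≡⟨ ℚ.+-comm (f (suc a)) _ ⟩
  ∑ (upTo (suc a)) f ℚ.+ f (suc a)                     ≡⟨ ∑-upTo-last (suc a) f ⟨
  ∑ (upTo (2 + a)) f                                   ∎

∑-antidiagonal-swap : ∀ a (t : ℕ → ℕ → ℚ) →
  ∑ (upTo (suc a)) (λ i → t i (a ∸ i)) ≡ ∑ (upTo (suc a)) (λ i → t (a ∸ i) i)
∑-antidiagonal-swap a t = trans (sym (∑-upTo-reverse a (λ i → t i (a ∸ i))))
  (∑-upTo-cong (suc a) λ i i<1+a → cong (t (a ∸ i)) (ℕ.m∸[m∸n]≡n (s≤s⁻¹ i<1+a)))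

-- Enlarging the triangle i + j ≤ a by one adds the diagonal i + j = a + 1.
∑-triangle-suc : ∀ a (t : ℕ → ℕ → ℚ) →
  ∑ (upTo (2 + a)) (λ i → ∑ (upTo (suc (suc a ∸ i))) (t i)) ≡
  ∑ (upTo (suc a)) (λ i → ∑ (upTo (suc (a ∸ i))) (t i)) ℚ.+
  ∑ (upTo (2 + a)) (λ i → t i (suc a ∸ i))
∑-triangle-suc a t = begin
  ∑ (upTo (2 + a)) (λ i → ∑ (upTo (suc (suc a ∸ i))) (t i))
    ≡⟨ ∑-cong (upTo (2 + a)) (λ i → ∑-upTo-last (suc a ∸ i) (t i)) ⟩
  ∑ (upTo (2 + a)) (λ i → ∑ (upTo (suc a ∸ i)) (t i) ℚ.+ t i (suc a ∸ i))
    ≡⟨ ∑-+ (upTo (2 + a)) (λ i → ∑ (upTo (suc a ∸ i)) (t i)) _ ⟩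
  ∑ (upTo (2 + a)) (λ i → ∑ (upTo (suc a ∸ i)) (t i)) ℚ.+ D
    ≡⟨ cong (ℚ._+ D) (∑-upTo-last (suc a) λ i → ∑ (upTo (suc a ∸ i)) (t i)) ⟩
  (∑ (upTo (suc a)) (λ i → ∑ (upTo (suc a ∸ i)) (t i)) ℚ.+ ∑ (upTo (suc a ∸ suc a)) (t (suc a))) ℚ.+ D
    -- Row a + 1 consisted of its diagonal entry alone and is now empty.
    ≡⟨ cong (ℚ._+ D) (cong₂ ℚ._+_
         (∑-upTo-cong (suc a) λ i i<1+a → cong (λ m → ∑ (upTo m) (t i)) (ℕ.+-∸-assoc 1 (s≤s⁻¹ i<1+a)))
         (cong (λ m → ∑ (upTo m) (t (suc a))) (ℕ.n∸n≡0 a))) ⟩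
  (∑ (upTo (suc a)) (λ i → ∑ (upTo (suc (a ∸ i))) (t i)) ℚ.+ 0ℚ) ℚ.+ D
    ≡⟨ cong (ℚ._+ D) (ℚ.+-identityʳ (∑ (upTo (suc a)) λ i → ∑ (upTo (suc (a ∸ i))) (t i))) ⟩
  ∑ (upTo (suc a)) (λ i → ∑ (upTo (suc (a ∸ i))) (t i)) ℚ.+ D
    ∎
  where D = ∑ (upTo (2 + a)) (λ i → t i (suc a ∸ i))

-- Induction on the size: the smaller triangle is symmetric by hypothesis, the new diagonal by
-- `∑-antidiagonal-swap`.
∑-triangle-swap : ∀ a (t : ℕ → ℕ → ℚ) →
  ∑ (upTo (suc a)) (λ i → ∑ (upTo (suc (a ∸ i))) (λ j → t i j)) ≡
  ∑ (upTo (suc a)) (λ j → ∑ (upTo (suc (a ∸ j))) (λ i → t i j))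
∑-triangle-swap zero    t = refl
∑-triangle-swap (suc a) t = trans (∑-triangle-suc a t) (trans
  (cong₂ ℚ._+_ (∑-triangle-swap a t) (∑-antidiagonal-swap (suc a) t))
  (sym (∑-triangle-suc a (λ j i → t i j))))

conv-∑ʳ : ∀ (xs : List A) f (g : A → Series) α →
          conv f (λ β → ∑ xs (λ x → g x β)) α ≡ ∑ xs (λ x → conv f (g x) α)
conv-∑ʳ xs f g []      = sym (∑-*ˡ xs (f []) (λ x → g x []))
conv-∑ʳ xs f g (a ∷ α) = trans
  (∑-cong (upTo (suc a)) λ i → conv-∑ʳ xs (λ β → f (i ∷ β)) (λ x γ → g x (a ∸ i ∷ γ)) α)
  (∑-comm (upTo (suc a)) xs λ i x → conv (λ β → f (i ∷ β)) (λ γ → g x (a ∸ i ∷ γ)) α)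

-- This law lets adjacent factors of a right-nested product trade places, which makes products of
-- power sums independent of the order. In the first exponent both sides range over i + j + k = a;
-- the triangle of pairs (i, j) is read by rows or by columns.
conv-leftComm : ∀ f g h α → conv f (conv g h) α ≡ conv g (conv f h) α
conv-leftComm f g h [] =
  solve 3 (λ a b c → a ⊠ (b ⊠ c) := b ⊠ (a ⊠ c)) refl (f []) (g []) (h [])
conv-leftComm f g h (a ∷ α) = begin
  ∑ (upTo (suc a)) (λ i → conv (f ∷ˡ i) (λ γ → conv g h (a ∸ i ∷ γ)) α)
    ≡⟨ expand f g ⟩
  ∑ (upTo (suc a)) (λ i → ∑ (upTo (suc (a ∸ i))) λ j →
    conv (f ∷ˡ i) (conv (g ∷ˡ j) (h ∷ˡ (a ∸ i ∸ j))) α)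
    ≡⟨ ∑-triangle-swap a (λ i j → conv (f ∷ˡ i) (conv (g ∷ˡ j) (h ∷ˡ (a ∸ i ∸ j))) α) ⟩
  ∑ (upTo (suc a)) (λ j → ∑ (upTo (suc (a ∸ j))) λ i →
    conv (f ∷ˡ i) (conv (g ∷ˡ j) (h ∷ˡ (a ∸ i ∸ j))) α)
    ≡⟨ ∑-cong (upTo (suc a)) (λ j → ∑-cong (upTo (suc (a ∸ j))) λ i → trans
         (conv-leftComm (f ∷ˡ i) (g ∷ˡ j) (h ∷ˡ (a ∸ i ∸ j)) α)
         (cong (λ b → conv (g ∷ˡ j) (conv (f ∷ˡ i) (h ∷ˡ b)) α) (∸-swap i j))) ⟩
  ∑ (upTo (suc a)) (λ j → ∑ (upTo (suc (a ∸ j))) λ i →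
    conv (g ∷ˡ j) (conv (f ∷ˡ i) (h ∷ˡ (a ∸ j ∸ i))) α)
    ≡⟨ expand g f ⟨
  ∑ (upTo (suc a)) (λ j → conv (g ∷ˡ j) (λ γ → conv f h (a ∸ j ∷ γ)) α)
    ∎
  where
  _∷ˡ_ : Series → ℕ → Series
  (f ∷ˡ i) β = f (i ∷ β)
  expand : ∀ f g → ∑ (upTo (suc a)) (λ i → conv (f ∷ˡ i) (λ γ → conv g h (a ∸ i ∷ γ)) α) ≡
    ∑ (upTo (suc a)) (λ i → ∑ (upTo (suc (a ∸ i))) λ j →
      conv (f ∷ˡ i) (conv (g ∷ˡ j) (h ∷ˡ (a ∸ i ∸ j))) α)
  expand f g = ∑-cong (upTo (suc a)) λ i →
    conv-∑ʳ (upTo (suc (a ∸ i))) (f ∷ˡ i) (λ j → conv (g ∷ˡ j) (h ∷ˡ (a ∸ i ∸ j))) α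
  ∸-swap : ∀ i j → a ∸ i ∸ j ≡ a ∸ j ∸ i
  ∸-swap i j = trans (ℕ.∸-+-assoc a i j) (trans (cong (a ∸_) (ℕ.+-comm i j)) (sym (ℕ.∸-+-assoc a j i)))

conv-•ˡ : ∀ c f g α → conv (λ β → c ℚ.* f β) g α ≡ c ℚ.* conv f g α
conv-•ˡ c f g []      = ℚ.*-assoc c (f []) (g [])
conv-•ˡ c f g (a ∷ α) = trans
  (∑-cong (upTo (suc a)) λ i → conv-•ˡ c (λ β → f (i ∷ β)) (λ γ → g (a ∸ i ∷ γ)) α)
  (∑-*ˡ (upTo (suc a)) c _)

conv-•ʳ : ∀ c f g α → conv f (λ β → c ℚ.* g β) α ≡ c ℚ.* conv f g α
conv-•ʳ c f g []      = solve 3 (λ a b c → a ⊠ (b ⊠ c) := b ⊠ (a ⊠ c)) refl (f []) c (g [])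
conv-•ʳ c f g (a ∷ α) = trans
  (∑-cong (upTo (suc a)) λ i → conv-•ʳ c (λ β → f (i ∷ β)) (λ γ → g (a ∸ i ∷ γ)) α)
  (∑-*ˡ (upTo (suc a)) c _)

conv-0ˡ : ∀ {f} g α → (∀ β → f β ≡ 0ℚ) → conv f g α ≡ 0ℚ
conv-0ˡ g α f≡0 = conv-zero α λ β γ _ → trans (cong (ℚ._* g γ) (f≡0 β)) (ℚ.*-zeroˡ (g γ))

conv-0ʳ : ∀ f {g} α → (∀ γ → g γ ≡ 0ℚ) → conv f g α ≡ 0ℚ
conv-0ʳ f α g≡0 = conv-zero α λ β γ _ → trans (cong (f β ℚ.*_) (g≡0 γ)) (ℚ.*-zeroʳ (f β))

const-⊛ : ∀ c f → const c ⊛ f ≈ c • f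
const-⊛ c f α = conv-const (coeff f) α
  where
  conv-const : ∀ g α → conv (coeff (const c)) g α ≡ c ℚ.* g α
  conv-const g []      = refl
  conv-const g (a ∷ α) = begin
    ∑ (upTo (suc a)) (λ i → conv (λ β → coeff (const c) (i ∷ β)) (λ γ → g (a ∸ i ∷ γ)) α)
      ≡⟨ ∑-upTo-head a (λ i → conv (λ β → coeff (const c) (i ∷ β)) (λ γ → g (a ∸ i ∷ γ)) α) ⟩
    conv (coeff (const c)) (λ γ → g (a ∷ γ)) α ℚ.+
    ∑ (upTo a) (λ i → conv (λ β → coeff (const c) (suc i ∷ β)) (λ γ → g (a ∸ suc i ∷ γ)) α)
      -- By computation, `nonzeroParts` drops a leading exponent 0, while a positive one makes the
      -- coefficient of the constant vanish.
      ≡⟨ cong₂ ℚ._+_ (conv-const (λ γ → g (a ∷ γ)) α)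
           (∑-zero (upTo a) λ {i} _ → conv-0ˡ (λ γ → g (a ∸ suc i ∷ γ)) α λ _ → refl) ⟩
    c ℚ.* g (a ∷ α) ℚ.+ 0ℚ
      ≡⟨ ℚ.+-identityʳ _ ⟩
    c ℚ.* g (a ∷ α)
      ∎

coeff-const0 : ∀ α → coeff (const 0ℚ) α ≡ 0ℚ
coeff-const0 α with does (hasParts? [] α)
... | true  = refl
... | false = refl

coeff-∑Λ : ∀ (xs : List A) (f : A → Λ) α → coeff (∑Λ xs f) α ≡ ∑ xs (λ x → coeff (f x) α)
coeff-∑Λ []       f α = coeff-const0 α
coeff-∑Λ (x ∷ xs) f α = cong (coeff (f x) α ℚ.+_) (coeff-∑Λ xs f α)

∑ₚ : List A → (A → Poly) → Poly
∑ₚ xs f = foldr (λ x s → f x :+ s) (con 0ℚ) xs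

monomial : List ℕ → Poly
monomial = foldr (λ k Q → X k :* Q) (con 1ℚ)

-- The witness for `_[x/x]≈_`: the Frobenius characteristic with indeterminates in place of power
-- sums, to be evaluated at `p` and at `shiftedPowerSum`. Scalars appear as constant factors.
frobeniusPoly : ∀ n → (Permutation′ n → ℚ) → Poly
frobeniusPoly n χ = con (inv (n !)) :* ∑ₚ (permutations n) λ w → con (χ w) :* monomial (cycleType w)
  where instance _ = n ℕ.!≢0

coeff-∑ₚ : ∀ (xs : List A) f ρ α → coeff (⟦ ∑ₚ xs f ⟧ ρ) α ≡ ∑ xs (λ x → coeff (⟦ f x ⟧ ρ) α)
coeff-∑ₚ []       f ρ α = coeff-const0 α
coeff-∑ₚ (x ∷ xs) f ρ α = cong (coeff (⟦ f x ⟧ ρ) α ℚ.+_) (coeff-∑ₚ xs f ρ α)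

coeff-frobeniusPoly : ∀ n χ ρ α → coeff (⟦ frobeniusPoly n χ ⟧ ρ) α ≡
  (_/_ (+ 1) (n !) {{ℕ._!≢0 n}}) ℚ.*
  ∑ (permutations n) (λ w → χ w ℚ.* coeff (⟦ monomial (cycleType w) ⟧ ρ) α)
coeff-frobeniusPoly n χ ρ α = trans (const-⊛ c (⟦ S ⟧ ρ) α) (cong (c ℚ.*_) (trans
  (coeff-∑ₚ (permutations n) (λ w → con (χ w) :* monomial (cycleType w)) ρ α)
  (∑-cong (permutations n) λ w → const-⊛ (χ w) (⟦ monomial (cycleType w) ⟧ ρ) α)))
  where
  c = _/_ (+ 1) (n !) {{ℕ._!≢0 n}}
  S = ∑ₚ (permutations n) λ w → con (χ w) :* monomial (cycleType w)

⟦monomial⟧p : ∀ μ → ⟦ monomial μ ⟧ p ≡ p⟨ μ ⟩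
⟦monomial⟧p []      = refl
⟦monomial⟧p (k ∷ μ) = cong (p k ⊛_) (⟦monomial⟧p μ)

⟦frobeniusPoly⟧p : ∀ n χ → frobenius n χ ≈ ⟦ frobeniusPoly n χ ⟧ p
⟦frobeniusPoly⟧p n χ α = sym (begin
  coeff (⟦ frobeniusPoly n χ ⟧ p) α
    ≡⟨ coeff-frobeniusPoly n χ p α ⟩
  c ℚ.* ∑ (permutations n) (λ w → χ w ℚ.* coeff (⟦ monomial (cycleType w) ⟧ p) α)
    ≡⟨ cong (c ℚ.*_) (∑-cong (permutations n) λ w →
         cong (λ f → χ w ℚ.* coeff f α) (⟦monomial⟧p (cycleType w))) ⟩
  c ℚ.* ∑ (permutations n) (λ w → χ w ℚ.* coeff p⟨ cycleType w ⟩ α)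
    ≡⟨ cong (c ℚ.*_) (coeff-∑Λ (permutations n) (λ w → χ w • p⟨ cycleType w ⟩) α) ⟨
  coeff (frobenius n χ) α
    ∎)
  where c = _/_ (+ 1) (n !) {{ℕ._!≢0 n}}

monomial-↭ : ∀ ρ {μ ν} → μ ↭ ν → ⟦ monomial μ ⟧ ρ ≈ ⟦ monomial ν ⟧ ρ
monomial-↭ ρ ↭-refl        α = refl
monomial-↭ ρ (prep k r)    α = conv-cong α (λ _ → refl) (monomial-↭ ρ r)
monomial-↭ ρ {_ ∷ _ ∷ μ} (swap j k r) α = trans
  (conv-leftComm (coeff (ρ j)) (coeff (ρ k)) (coeff (⟦ monomial μ ⟧ ρ)) α)
  (conv-cong α (λ _ → refl) λ β → conv-cong β (λ _ → refl) (monomial-↭ ρ r))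
monomial-↭ ρ (↭-trans′ r s) α = trans (monomial-↭ ρ r α) (monomial-↭ ρ s α)

shiftedPowerSum-odd : ∀ {k} → Odd k → shiftedPowerSum k ≡ (+ 2 / 1) • p k
shiftedPowerSum-odd {k} k-odd = cong (λ b → if b then const 0ℚ else (+ 2 / 1) • p k) (dec-false (2 ∣? k) k-odd)

shiftedPowerSum-even : ∀ {k} → 2 ∣ k → shiftedPowerSum k ≡ const 0ℚ
shiftedPowerSum-even {k} 2∣k = cong (λ b → if b then const 0ℚ else (+ 2 / 1) • p k) (dec-true (2 ∣? k) 2∣k)

monomial-shifted-odd : ∀ {μ} → All Odd μ →
  ⟦ monomial μ ⟧ shiftedPowerSum ≈ ι (2 ^ length μ) • p⟨ μ ⟩
monomial-shifted-odd []                  α = sym (ℚ.*-identityˡ _)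
monomial-shifted-odd {k ∷ μ} (k-odd ∷ μ-odd) α = begin
  conv (coeff (shiftedPowerSum k)) (coeff (⟦ monomial μ ⟧ shiftedPowerSum)) α
    ≡⟨ conv-cong α (λ β → cong (λ f → coeff f β) (shiftedPowerSum-odd k-odd)) (monomial-shifted-odd μ-odd) ⟩
  conv (λ β → ι 2 ℚ.* coeff (p k) β) (λ β → ι (2 ^ length μ) ℚ.* coeff p⟨ μ ⟩ β) α
    ≡⟨ conv-•ˡ (ι 2) (coeff (p k)) _ α ⟩
  ι 2 ℚ.* conv (coeff (p k)) (λ β → ι (2 ^ length μ) ℚ.* coeff p⟨ μ ⟩ β) α
    ≡⟨ cong (ι 2 ℚ.*_) (conv-•ʳ (ι (2 ^ length μ)) (coeff (p k)) _ α) ⟩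
  ι 2 ℚ.* (ι (2 ^ length μ) ℚ.* coeff p⟨ k ∷ μ ⟩ α)
    ≡⟨ ℚ.*-assoc (ι 2) (ι (2 ^ length μ)) _ ⟨
  ι 2 ℚ.* ι (2 ^ length μ) ℚ.* coeff p⟨ k ∷ μ ⟩ α
    ≡⟨ cong (ℚ._* coeff p⟨ k ∷ μ ⟩ α) (ι-* 2 (2 ^ length μ)) ⟨
  ι (2 ^ suc (length μ)) ℚ.* coeff p⟨ k ∷ μ ⟩ α
    ∎

monomial-shifted-even : ∀ {μ} → ¬ All Odd μ → ∀ α → coeff (⟦ monomial μ ⟧ shiftedPowerSum) α ≡ 0ℚ
monomial-shifted-even {[]}    ¬odd α = contradiction [] ¬odd
monomial-shifted-even {k ∷ μ} ¬odd α = case 2 ∣? k of λ where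
  (yes 2∣k)   → conv-0ˡ (coeff (⟦ monomial μ ⟧ shiftedPowerSum)) α λ β →
    trans (cong (λ f → coeff f β) (shiftedPowerSum-even 2∣k)) (coeff-const0 β)
  (no  k-odd) → conv-0ʳ (coeff (shiftedPowerSum k)) α
    (monomial-shifted-even λ μ-odd → ¬odd (k-odd ∷ μ-odd))

-- Cycle types under insertion of a point

filter-map : ∀ {P : B → Set} (P? : Decidable P) (f : A → B) xs →
             filter P? (map f xs) ≡ map f (filter (P? ∘ f) xs)
filter-map P? f []       = refl
filter-map P? f (x ∷ xs) with P? (f x)
... | yes _ = cong (f x ∷_) (filter-map P? f xs)
... | no  _ = filter-map P? f xs

filter-× : ∀ {P Q : A → Set} (P? : Decidable P) (Q? : Decidable Q) xs →
           filter (λ x → P? x ×-dec Q? x) xs ≡ filter Q? (filter P? xs)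
filter-× P? Q? []       = refl
filter-× P? Q? (x ∷ xs) with P? x
... | no  _ = filter-× P? Q? xs
... | yes _ with Q? x
...   | yes _ = cong (x ∷_) (filter-× P? Q? xs)
...   | no  _ = filter-× P? Q? xs

filter-allFin-accept : ∀ {P : Fin (suc n) → Set} (P? : Decidable P) → P Fin.zero →
  filter P? (allFin (suc n)) ≡ Fin.zero ∷ map Fin.suc (filter (P? ∘ Fin.suc) (allFin n))
filter-allFin-accept {n} P? P0 = begin
  filter P? (allFin (suc n))                                  ≡⟨ cong (filter P?) (allFin-suc n) ⟩
  filter P? (Fin.zero ∷ map Fin.suc (allFin n))               ≡⟨ List.filter-accept P? P0 ⟩
  Fin.zero ∷ filter P? (map Fin.suc (allFin n))               ≡⟨ cong (Fin.zero ∷_) (filter-map P? Fin.suc (allFin n)) ⟩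
  Fin.zero ∷ map Fin.suc (filter (P? ∘ Fin.suc) (allFin n))   ∎

filter-allFin-reject : ∀ {P : Fin (suc n) → Set} (P? : Decidable P) → ¬ P Fin.zero →
  filter P? (allFin (suc n)) ≡ map Fin.suc (filter (P? ∘ Fin.suc) (allFin n))
filter-allFin-reject {n} P? ¬P0 = begin
  filter P? (allFin (suc n))                                  ≡⟨ cong (filter P?) (allFin-suc n) ⟩
  filter P? (Fin.zero ∷ map Fin.suc (allFin n))               ≡⟨ List.filter-reject P? ¬P0 ⟩
  filter P? (map Fin.suc (allFin n))                          ≡⟨ filter-map P? Fin.suc (allFin n) ⟩
  map Fin.suc (filter (P? ∘ Fin.suc) (allFin n))              ∎

least : ∀ {P : Fin n → Set} (P? : Decidable P) → ∃ P → ∃ λ i → P i × (∀ k → P k → i Fin.≤ k)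
least {suc n} P? (i , Pi) with P? Fin.zero
... | yes P0 = Fin.zero , P0 , λ _ _ → z≤n
least {suc n} P? (Fin.zero  , Pi) | no ¬P0 = contradiction Pi ¬P0
least {suc n} P? (Fin.suc i , Pi) | no ¬P0 with least (P? ∘ Fin.suc) (i , Pi)
... | i₀ , Pi₀ , min = Fin.suc i₀ , Pi₀ , λ where
  Fin.zero    P0 → contradiction P0 ¬P0
  (Fin.suc k) Pk → s≤s (min k Pk)

-- `SameCycle` without the bound on the exponent. In this form exponents can be added freely;
-- `period` and `reduce` restore the bound.
Reaches : Permutation′ n → Fin n → Fin n → Set
Reaches w i k = ∃ λ j → fold i (w ⟨$⟩ʳ_) j ≡ k

reaches-trans : ∀ (w : Permutation′ n) {i k l} → Reaches w i k → Reaches w k l → Reaches w i l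
reaches-trans w {i} (j , refl) (j′ , refl) = j′ + j , fold-+ i (w ⟨$⟩ʳ_) j′

fold-injective : ∀ (w : Permutation′ n) m {i k} →
                 fold i (w ⟨$⟩ʳ_) m ≡ fold k (w ⟨$⟩ʳ_) m → i ≡ k
fold-injective w zero    eq = eq
fold-injective w (suc m) eq = fold-injective w m
  (trans (sym (Perm.inverseˡ w)) (trans (cong (w ⟨$⟩ˡ_) eq) (Perm.inverseˡ w)))

-- Two of the n + 1 iterates with exponents 0, ..., n agree. Cancelling the smaller power leaves a
-- positive period of at most n.
period : ∀ (w : Permutation′ n) i → ∃ λ d → suc d ≤ n × fold i (w ⟨$⟩ʳ_) (suc d) ≡ i
period {n} w i with Fin.pigeonhole (ℕ.n<1+n n) (λ j → fold i (w ⟨$⟩ʳ_) (toℕ j))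
... | a , b , a<b , eq with ℕ.m≤n⇒∃[o]m+o≡n a<b
...   | d , 1+a+d≡b = d
    , ℕ.≤-trans (subst (suc d ≤_) a+1+d≡b (ℕ.m≤n+m (suc d) (toℕ a))) (s≤s⁻¹ (Fin.toℕ<n b))
    , fold-injective w (toℕ a) (begin
        fold (fold i step (suc d)) step (toℕ a) ≡⟨ fold-+ i step (toℕ a) ⟨
        fold i step (toℕ a + suc d)             ≡⟨ cong (fold i step) a+1+d≡b ⟩
        fold i step (toℕ b)                     ≡⟨ eq ⟨
        fold i step (toℕ a)                     ∎)
  where
  step = w ⟨$⟩ʳ_
  a+1+d≡b = trans (ℕ.+-suc (toℕ a) d) 1+a+d≡b

-- Reduction of the exponent modulo the period d + 1: count up and restart at 0 after d.
reduce : ∀ (w : Permutation′ n) i d → fold i (w ⟨$⟩ʳ_) (suc d) ≡ i →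
         ∀ j → ∃ λ j′ → j′ ≤ d × fold i (w ⟨$⟩ʳ_) j′ ≡ fold i (w ⟨$⟩ʳ_) j
reduce w i d per zero    = 0 , z≤n , refl
reduce w i d per (suc j) with reduce w i d per j
... | j′ , j′≤d , eq with ℕ.m≤n⇒m<n∨m≡n j′≤d
...   | inj₁ j′<d = suc j′ , j′<d , cong (w ⟨$⟩ʳ_) eq
...   | inj₂ refl = 0 , z≤n , trans (sym per) (cong (w ⟨$⟩ʳ_) eq)

reaches⇒sameCycle : ∀ (w : Permutation′ n) {i k} → Reaches w i k → SameCycle w i k
reaches⇒sameCycle w {i} (j , refl) with period w i
... | d , d<n , per with reduce w i d per j
...   | j′ , j′≤d , eq = fromℕ< j′<n
    , trans (cong (fold i (w ⟨$⟩ʳ_)) (Fin.toℕ-fromℕ< j′<n)) eq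
  where j′<n = ℕ.≤-<-trans j′≤d d<n

sameCycle⇒reaches : ∀ (w : Permutation′ n) {i k} → SameCycle w i k → Reaches w i k
sameCycle⇒reaches w (j , eq) = toℕ j , eq

-- Following the cycle for the rest of its period leads back to the start.
reaches-sym : ∀ (w : Permutation′ n) {i k} → Reaches w i k → Reaches w k i
reaches-sym w {i} (j , refl) with period w i
... | d , _ , per with reduce w i d per j
...   | j′ , j′≤d , eq = suc d ∸ j′ , (begin
    fold (fold i step j) step (suc d ∸ j′)  ≡⟨ cong (λ k → fold k step (suc d ∸ j′)) eq ⟨
    fold (fold i step j′) step (suc d ∸ j′) ≡⟨ fold-+ i step (suc d ∸ j′) ⟨
    fold i step (suc d ∸ j′ + j′)           ≡⟨ cong (fold i step) (ℕ.m∸n+n≡m (ℕ.m≤n⇒m≤1+n j′≤d)) ⟩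
    fold i step (suc d)                     ≡⟨ per ⟩
    i                                       ∎)
  where step = w ⟨$⟩ʳ_

sameCycle-refl : ∀ (w : Permutation′ n) i → SameCycle w i i
sameCycle-refl w i = reaches⇒sameCycle w (0 , refl)

sameCycle-sym : ∀ (w : Permutation′ n) {i k} → SameCycle w i k → SameCycle w k i
sameCycle-sym w = reaches⇒sameCycle w ∘ reaches-sym w ∘ sameCycle⇒reaches w

sameCycle-trans : ∀ (w : Permutation′ n) {i k l} →
                  SameCycle w i k → SameCycle w k l → SameCycle w i l
sameCycle-trans w p q =
  reaches⇒sameCycle w (reaches-trans w (sameCycle⇒reaches w p) (sameCycle⇒reaches w q))

-- The step by which `permutations` is built, so sums over `permutations (suc n)` split into sums
-- over insertions. The new point 0 is sent to j; it is a fixed point for j = 0.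
insert : Permutation′ n → Fin (suc n) → Permutation′ (suc n)
insert π j = lift₀ π ∘ₚ transpose Fin.zero j

-- One point for each cycle; `cycleType w` is by definition the list of cycle lengths at these
-- points.
leaders : Permutation′ n → List (Fin n)
leaders w = filter (isLeast? w) (allFin _)

leadersOutside : Permutation′ n → Fin n → List (Fin n)
leadersOutside w k = filter (λ a → ¬? (sameCycle? w k a)) (leaders w)

module InsertFixedPoint (π : Permutation′ n) where

  σ : Permutation′ (suc n)
  σ = insert π Fin.zero

  fold-zero : ∀ j → fold Fin.zero (σ ⟨$⟩ʳ_) j ≡ Fin.zero
  fold-zero zero    = refl
  fold-zero (suc j) = cong (σ ⟨$⟩ʳ_) (fold-zero j)

  fold-suc : ∀ a j → fold (Fin.suc a) (σ ⟨$⟩ʳ_) j ≡ Fin.suc (fold a (π ⟨$⟩ʳ_) j)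
  fold-suc a zero    = refl
  fold-suc a (suc j) = cong (σ ⟨$⟩ʳ_) (fold-suc a j)

  ¬same-zero-suc : ∀ {a} → ¬ SameCycle σ Fin.zero (Fin.suc a)
  ¬same-zero-suc (j , eq) with () ← trans (sym (fold-zero (toℕ j))) eq

  ¬same-suc-zero : ∀ {a} → ¬ SameCycle σ (Fin.suc a) Fin.zero
  ¬same-suc-zero {a} (j , eq) with () ← trans (sym (fold-suc a (toℕ j))) eq

  same-suc⁺ : ∀ {a b} → SameCycle π a b → SameCycle σ (Fin.suc a) (Fin.suc b)
  same-suc⁺ {a} (j , eq) =
    reaches⇒sameCycle σ (toℕ j , trans (fold-suc a (toℕ j)) (cong Fin.suc eq))

  same-suc⁻ : ∀ {a b} → SameCycle σ (Fin.suc a) (Fin.suc b) → SameCycle π a b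
  same-suc⁻ {a} (j , eq) =
    reaches⇒sameCycle π (toℕ j , Fin.suc-injective (trans (sym (fold-suc a (toℕ j))) eq))

  cycleLength-zero : cycleLength σ Fin.zero ≡ 1
  cycleLength-zero = begin
    length (filter same₀? (allFin (suc n)))
      ≡⟨ cong length (filter-allFin-accept same₀? (sameCycle-refl σ Fin.zero)) ⟩
    suc (length (map Fin.suc (filter (same₀? ∘ Fin.suc) (allFin n))))
      ≡⟨ cong (suc ∘ length ∘ map Fin.suc)
           (List.filter-none (same₀? ∘ Fin.suc) (All.universal (λ _ → ¬same-zero-suc) (allFin n))) ⟩
    1 ∎
    where same₀? = sameCycle? σ Fin.zero

  cycleLength-suc : ∀ a → cycleLength σ (Fin.suc a) ≡ cycleLength π a
  cycleLength-suc a = begin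
    length (filter same? (allFin (suc n)))
      ≡⟨ cong length (filter-allFin-reject same? ¬same-suc-zero) ⟩
    length (map Fin.suc (filter (same? ∘ Fin.suc) (allFin n)))
      ≡⟨ List.length-map Fin.suc (filter (same? ∘ Fin.suc) (allFin n)) ⟩
    length (filter (same? ∘ Fin.suc) (allFin n))
      ≡⟨ cong length (List.filter-≐ (same? ∘ Fin.suc) (sameCycle? π a) (same-suc⁻ , same-suc⁺) (allFin n)) ⟩
    cycleLength π a ∎
    where same? = sameCycle? σ (Fin.suc a)

  isLeast-suc⁻ : ∀ {a} → IsLeast σ (Fin.suc a) → IsLeast π a
  isLeast-suc⁻ min k s = s≤s⁻¹ (min (Fin.suc k) (same-suc⁺ s))

  isLeast-suc⁺ : ∀ {a} → IsLeast π a → IsLeast σ (Fin.suc a)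
  isLeast-suc⁺ min Fin.zero    s = contradiction s ¬same-suc-zero
  isLeast-suc⁺ min (Fin.suc k) s = s≤s (min k (same-suc⁻ s))

  cycleType-insert : cycleType σ ≡ 1 ∷ cycleType π
  cycleType-insert = begin
    map (cycleLength σ) (filter (isLeast? σ) (allFin (suc n)))
      ≡⟨ cong (map (cycleLength σ)) (filter-allFin-accept (isLeast? σ) (λ _ _ → z≤n)) ⟩
    cycleLength σ Fin.zero ∷ map (cycleLength σ) (map Fin.suc (filter (isLeast? σ ∘ Fin.suc) (allFin n)))
      ≡⟨ cong (_∷ map (cycleLength σ) (map Fin.suc (filter (isLeast? σ ∘ Fin.suc) (allFin n)))) cycleLength-zero ⟩
    1 ∷ map (cycleLength σ) (map Fin.suc (filter (isLeast? σ ∘ Fin.suc) (allFin n)))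
      ≡⟨ cong (λ xs → 1 ∷ map (cycleLength σ) (map Fin.suc xs))
           (List.filter-≐ (isLeast? σ ∘ Fin.suc) (isLeast? π) (isLeast-suc⁻ , isLeast-suc⁺) (allFin n)) ⟩
    1 ∷ map (cycleLength σ) (map Fin.suc (leaders π))
      ≡⟨ cong (1 ∷_) (List.map-∘ (leaders π)) ⟨
    1 ∷ map (cycleLength σ ∘ Fin.suc) (leaders π)
      ≡⟨ cong (1 ∷_) (List.map-cong cycleLength-suc (leaders π)) ⟩
    1 ∷ cycleType π
      ∎

module InsertIntoCycle (π : Permutation′ n) (k : Fin n) where

  σ : Permutation′ (suc n)
  σ = insert π (Fin.suc k)

  -- The new point 0 is inserted directly in front of k.
  contract : Fin (suc n) → Fin n
  contract Fin.zero    = k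
  contract (Fin.suc a) = a

  step-suc-≡ : ∀ {a} → π ⟨$⟩ʳ a ≡ k → σ ⟨$⟩ʳ Fin.suc a ≡ Fin.zero
  step-suc-≡ {a} eq rewrite dec-true (π ⟨$⟩ʳ a Fin.≟ k) eq = refl

  step-suc-≢ : ∀ {a} → π ⟨$⟩ʳ a ≢ k → σ ⟨$⟩ʳ Fin.suc a ≡ Fin.suc (π ⟨$⟩ʳ a)
  step-suc-≢ {a} neq rewrite dec-false (π ⟨$⟩ʳ a Fin.≟ k) neq = refl

  contract-step : ∀ a → contract (σ ⟨$⟩ʳ Fin.suc a) ≡ π ⟨$⟩ʳ a
  contract-step a = case π ⟨$⟩ʳ a Fin.≟ k of λ where
    (yes eq) → trans (cong contract (step-suc-≡ eq)) (sym eq)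
    (no neq) → cong contract (step-suc-≢ neq)

  -- After contraction a step of σ is a step of π, except that the step from 0 to k becomes a rest
  -- at k.
  contract-reaches : ∀ {x y} → Reaches σ x y → Reaches π (contract x) (contract y)
  contract-reaches (zero  , refl) = 0 , refl
  contract-reaches {x} (suc j , refl) = reaches-trans π (contract-reaches (j , refl)) (step (fold x (σ ⟨$⟩ʳ_) j))
    where
    step : ∀ y → Reaches π (contract y) (contract (σ ⟨$⟩ʳ y))
    step Fin.zero    = 0 , refl
    step (Fin.suc a) = 1 , sym (contract-step a)

  expand-reaches : ∀ {a b} → Reaches π a b → Reaches σ (Fin.suc a) (Fin.suc b)
  expand-reaches (zero  , refl) = 0 , refl
  expand-reaches {a} (suc j , refl) = reaches-trans σ (expand-reaches (j , refl)) (step (fold a (π ⟨$⟩ʳ_) j))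
    where
    step : ∀ b → Reaches σ (Fin.suc b) (Fin.suc (π ⟨$⟩ʳ b))
    step b = case π ⟨$⟩ʳ b Fin.≟ k of λ where
      -- A step of π into k takes a detour through the new point, hence two steps of σ.
      (yes eq) → 2 , trans (cong (σ ⟨$⟩ʳ_) (step-suc-≡ eq)) (cong Fin.suc (sym eq))
      (no neq) → 1 , step-suc-≢ neq

  reaches-contract : ∀ x → Reaches σ x (Fin.suc (contract x))
  reaches-contract Fin.zero    = 1 , refl
  reaches-contract (Fin.suc a) = 0 , refl

  same⁻ : ∀ {x y} → SameCycle σ x y → SameCycle π (contract x) (contract y)
  same⁻ = reaches⇒sameCycle π ∘ contract-reaches ∘ sameCycle⇒reaches σ

  same⁺ : ∀ {x y} → SameCycle π (contract x) (contract y) → SameCycle σ x y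
  same⁺ {x} {y} s = reaches⇒sameCycle σ (reaches-trans σ (reaches-contract x)
    (reaches-trans σ (expand-reaches (sameCycle⇒reaches π s)) (reaches-sym σ (reaches-contract y))))

  cycleLength-zero : cycleLength σ Fin.zero ≡ suc (cycleLength π k)
  cycleLength-zero = begin
    length (filter same? (allFin (suc n)))
      ≡⟨ cong length (filter-allFin-accept same? (sameCycle-refl σ Fin.zero)) ⟩
    suc (length (map Fin.suc (filter (same? ∘ Fin.suc) (allFin n))))
      ≡⟨ cong suc (List.length-map Fin.suc (filter (same? ∘ Fin.suc) (allFin n))) ⟩
    suc (length (filter (same? ∘ Fin.suc) (allFin n)))
      ≡⟨ cong (suc ∘ length) (List.filter-≐ (same? ∘ Fin.suc) (sameCycle? π k) (same⁻ , same⁺) (allFin n)) ⟩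
    suc (cycleLength π k) ∎
    where same? = sameCycle? σ Fin.zero

  cycleLength-suc : ∀ {a} → ¬ SameCycle π k a → cycleLength σ (Fin.suc a) ≡ cycleLength π a
  cycleLength-suc {a} ¬s = begin
    length (filter same? (allFin (suc n)))
      ≡⟨ cong length (filter-allFin-reject same? (¬s ∘ sameCycle-sym π ∘ same⁻)) ⟩
    length (map Fin.suc (filter (same? ∘ Fin.suc) (allFin n)))
      ≡⟨ List.length-map Fin.suc (filter (same? ∘ Fin.suc) (allFin n)) ⟩
    length (filter (same? ∘ Fin.suc) (allFin n))
      ≡⟨ cong length (List.filter-≐ (same? ∘ Fin.suc) (sameCycle? π a) (same⁻ , same⁺) (allFin n)) ⟩
    cycleLength π a ∎
    where same? = sameCycle? σ (Fin.suc a)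

  isLeast-suc⁻ : ∀ {a} → IsLeast σ (Fin.suc a) → IsLeast π a × ¬ SameCycle π k a
  isLeast-suc⁻ min = (λ b s → s≤s⁻¹ (min (Fin.suc b) (same⁺ s))) , λ s →
    contradiction (min Fin.zero (same⁺ (sameCycle-sym π s))) λ ()

  isLeast-suc⁺ : ∀ {a} → IsLeast π a × ¬ SameCycle π k a → IsLeast σ (Fin.suc a)
  isLeast-suc⁺ (min , ¬s) Fin.zero    s = contradiction (sameCycle-sym π (same⁻ s)) ¬s
  isLeast-suc⁺ (min , ¬s) (Fin.suc b) s = s≤s (min b (same⁻ s))

  -- Being the least point, 0 leads the enlarged cycle and stands first in the list; the former
  -- leader of that cycle drops out, and all other leaders remain in order.
  cycleType-insert : cycleType σ ≡ suc (cycleLength π k) ∷ map (cycleLength π) (leadersOutside π k)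
  cycleType-insert = begin
    map (cycleLength σ) (filter (isLeast? σ) (allFin (suc n)))
      ≡⟨ cong (map (cycleLength σ)) (filter-allFin-accept (isLeast? σ) (λ _ _ → z≤n)) ⟩
    cycleLength σ Fin.zero ∷ map (cycleLength σ) (map Fin.suc (filter (isLeast? σ ∘ Fin.suc) (allFin n)))
      ≡⟨ cong (_∷ map (cycleLength σ) (map Fin.suc (filter (isLeast? σ ∘ Fin.suc) (allFin n)))) cycleLength-zero ⟩
    c ∷ map (cycleLength σ) (map Fin.suc (filter (isLeast? σ ∘ Fin.suc) (allFin n)))
      ≡⟨ cong (λ xs → c ∷ map (cycleLength σ) (map Fin.suc xs)) (trans
           (List.filter-≐ (isLeast? σ ∘ Fin.suc) (λ a → isLeast? π a ×-dec outside? a)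
             (isLeast-suc⁻ , isLeast-suc⁺) (allFin n))
           (filter-× (isLeast? π) outside? (allFin n))) ⟩
    c ∷ map (cycleLength σ) (map Fin.suc (leadersOutside π k))
      ≡⟨ cong (c ∷_) (List.map-∘ (leadersOutside π k)) ⟨
    c ∷ map (cycleLength σ ∘ Fin.suc) (leadersOutside π k)
      ≡⟨ cong (c ∷_) (List.map-cong-local (All.tabulate λ a∈ →
           cycleLength-suc (proj₂ (∈-filter⁻ outside? {xs = leaders π} a∈)))) ⟩
    c ∷ map (cycleLength π) (leadersOutside π k)
      ∎
    where
    c = suc (cycleLength π k)
    outside? = λ a → ¬? (sameCycle? π k a)

-- Every position is singled out once, with the remaining entries beside it. Equal entries count
-- separately, as cycles of equal length must.
selections : List A → List (A × List A)
selections []       = []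
selections (x ∷ xs) = (x , xs) ∷ map (λ (y , ys) → y , x ∷ ys) (selections xs)

-- Distinct members of `L` are unrelated, so discarding everything related to x discards x alone.
-- With leaders for `L`, `SameCycle` for `R` and cycle length for `c`, a sum over cycles becomes a
-- sum over parts of the cycle type.
∑-selections : ∀ {R : A → A → Set} (R? : ∀ x → Decidable (R x)) (c : A → B) {L} → Unique L →
  (∀ x → R x x) → (∀ {x y} → x ∈ L → y ∈ L → R x y → x ≡ y) → (H : B → List B → ℚ) →
  ∑ L (λ x → H (c x) (map c (filter (λ y → ¬? (R? x y)) L))) ≡
  ∑ (selections (map c L)) (λ (b , r) → H b r)
∑-selections R? c {[]}    _          R-refl sep H = refl
∑-selections R? c {x ∷ L} (x∉L ∷ uL) R-refl sep H = cong₂ ℚ._+_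
  (cong (H (c x) ∘ map c) (trans
    (List.filter-reject (λ y → ¬? (R? x y)) (λ ¬r → ¬r (R-refl x)))
    (List.filter-all (λ y → ¬? (R? x y)) (All.tabulate λ y∈ r →
      All.lookup x∉L y∈ (sep (here refl) (there y∈) r)))))
  (begin
    ∑ L (λ y → H (c y) (map c (filter (λ z → ¬? (R? y z)) (x ∷ L))))
      ≡⟨ ∑-cong-∈ L (λ {y} y∈ → cong (H (c y) ∘ map c)
           (List.filter-accept (λ z → ¬? (R? y z)) λ r →
             All.lookup x∉L y∈ (sym (sep (there y∈) (here refl) r)))) ⟩
    ∑ L (λ y → H (c y) (c x ∷ map c (filter (λ z → ¬? (R? y z)) L)))
      ≡⟨ ∑-selections R? c uL R-refl (λ x∈ y∈ → sep (there x∈) (there y∈)) (λ b r → H b (c x ∷ r)) ⟩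
    ∑ (selections (map c L)) (λ (b , r) → H b (c x ∷ r))
      ≡⟨ ∑-map (λ (y , ys) → y , c x ∷ ys) (selections (map c L)) (λ (b , r) → H b r) ⟨
    ∑ (map (λ (y , ys) → y , c x ∷ ys) (selections (map c L))) (λ (b , r) → H b r)
      ∎)

leaders-unique : (w : Permutation′ n) → Unique (leaders w)
leaders-unique w = Unique.filter⁺ (isLeast? w) (Unique.allFin⁺ _)

leader-isLeast : ∀ (w : Permutation′ n) {i} → i ∈ leaders w → IsLeast w i
leader-isLeast w = proj₂ ∘ ∈-filter⁻ (isLeast? w) {xs = allFin _}

leaders-separated : ∀ (w : Permutation′ n) {i k} → i ∈ leaders w → k ∈ leaders w →
                    SameCycle w i k → i ≡ k
leaders-separated w {i} {k} i∈ k∈ s = Fin.≤-antisym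
  (leader-isLeast w i∈ k s) (leader-isLeast w k∈ i (sameCycle-sym w s))

leader : ∀ (w : Permutation′ n) k → ∃ λ i → i ∈ leaders w × SameCycle w i k
leader w k with least (sameCycle? w k) (k , sameCycle-refl w k)
... | i , s , min = i
    , ∈-filter⁺ (isLeast? w) (∈-allFin i) (λ l s′ → min l (sameCycle-trans w s s′))
    , sameCycle-sym w s

-- Write `h k` as its value at the leader of the cycle of k and exchange the sums; each leader is
-- then counted once for every point of its cycle.
∑-by-cycles : ∀ (w : Permutation′ n) (h : Fin n → ℚ) → (∀ {i k} → SameCycle w i k → h i ≡ h k) →
              ∑ (allFin n) h ≡ ∑ (leaders w) (λ i → ι (cycleLength w i) ℚ.* h i)
∑-by-cycles {n} w h inv = begin
  ∑ (allFin n) h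
    ≡⟨ ∑-cong (allFin n) via-leader ⟩
  ∑ (allFin n) (λ k → ∑ (leaders w) λ i → 𝟙 (sameCycle? w i k) ℚ.* h i)
    ≡⟨ ∑-comm (allFin n) (leaders w) (λ k i → 𝟙 (sameCycle? w i k) ℚ.* h i) ⟩
  ∑ (leaders w) (λ i → ∑ (allFin n) λ k → 𝟙 (sameCycle? w i k) ℚ.* h i)
    ≡⟨ ∑-cong (leaders w) (λ i → trans (∑-*ʳ (allFin n) (h i) (λ k → 𝟙 (sameCycle? w i k)))
         (cong (ℚ._* h i) (sym (ι-length-filter (sameCycle? w i) (allFin n))))) ⟩
  ∑ (leaders w) (λ i → ι (cycleLength w i) ℚ.* h i)
    ∎
  where
  via-leader : ∀ k → h k ≡ ∑ (leaders w) λ i → 𝟙 (sameCycle? w i k) ℚ.* h i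
  via-leader k with leader w k
  ... | i , i∈ , s = sym (begin
    ∑ (leaders w) (λ i → 𝟙 (sameCycle? w i k) ℚ.* h i)
      ≡⟨ ∑-unique (leaders-unique w) i∈ (λ {l} l∈ l≢i → trans
           (cong (ℚ._* h l) (𝟙-no (sameCycle? w l k) λ s′ → l≢i
             (leaders-separated w l∈ i∈ (sameCycle-trans w s′ (sameCycle-sym w s)))))
           (ℚ.*-zeroˡ (h l))) ⟩
    𝟙 (sameCycle? w i k) ℚ.* h i
      ≡⟨ cong (ℚ._* h i) (𝟙-yes (sameCycle? w i k) s) ⟩
    1ℚ ℚ.* h i
      ≡⟨ ℚ.*-identityˡ (h i) ⟩
    h i
      ≡⟨ inv s ⟩
    h k ∎)

-- The sum of F over the cycle types that arise by inserting a point into a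
-- permutation of cycle type μ; a cycle of length c offers c places.
augment : (List ℕ → ℚ) → List ℕ → ℚ
augment F μ = F (1 ∷ μ) ℚ.+ ∑ (selections μ) λ (c , r) → ι c ℚ.* F (suc c ∷ r)

∑-cycleType-suc : ∀ n (F : List ℕ → ℚ) →
  ∑ (permutations (suc n)) (F ∘ cycleType) ≡ ∑ (permutations n) (augment F ∘ cycleType)
∑-cycleType-suc n F = begin
  ∑ (permutations (suc n)) (F ∘ cycleType)
    ≡⟨ ∑-cartesianProductWith (λ j π → insert π j) (allFin (suc n)) (permutations n) (F ∘ cycleType) ⟩
  ∑ (allFin (suc n)) (λ j → ∑ (permutations n) λ π → F (cycleType (insert π j)))
    ≡⟨ ∑-comm (allFin (suc n)) (permutations n) (λ j π → F (cycleType (insert π j))) ⟩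
  ∑ (permutations n) (λ π → ∑ (allFin (suc n)) λ j → F (cycleType (insert π j)))
    ≡⟨ ∑-cong (permutations n) (λ π → trans
         (∑-allFin-suc n (λ j → F (cycleType (insert π j))))
         (cong₂ ℚ._+_ (cong F (InsertFixedPoint.cycleType-insert π)) (into-cycles π))) ⟩
  ∑ (permutations n) (augment F ∘ cycleType)
    ∎
  where
  into-cycles : ∀ π → ∑ (allFin n) (λ k → F (cycleType (insert π (Fin.suc k)))) ≡
                      ∑ (selections (cycleType π)) (λ (c , r) → ι c ℚ.* F (suc c ∷ r))
  into-cycles π = begin
    ∑ (allFin n) (λ k → F (cycleType (insert π (Fin.suc k))))
      ≡⟨ ∑-cong (allFin n) (λ k → cong F (InsertIntoCycle.cycleType-insert π k)) ⟩
    ∑ (allFin n) h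
      ≡⟨ ∑-by-cycles π h h-invariant ⟩
    ∑ (leaders π) (λ i → ι (cycleLength π i) ℚ.* h i)
      ≡⟨ ∑-selections (sameCycle? π) (cycleLength π) (leaders-unique π) (sameCycle-refl π)
           (leaders-separated π) (λ c r → ι c ℚ.* F (suc c ∷ r)) ⟩
    ∑ (selections (cycleType π)) (λ (c , r) → ι c ℚ.* F (suc c ∷ r))
      ∎
    where
    h : Fin n → ℚ
    h k = F (suc (cycleLength π k) ∷ map (cycleLength π) (leadersOutside π k))
    h-invariant : ∀ {i k} → SameCycle π i k → h i ≡ h k
    h-invariant {i} {k} s = cong₂ (λ c xs → F (suc (length c) ∷ map (cycleLength π) xs))
      (List.filter-≐ (sameCycle? π i) (sameCycle? π k)
        (sameCycle-trans π (sameCycle-sym π s) , sameCycle-trans π s) (allFin n))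
      (List.filter-≐ (λ a → ¬? (sameCycle? π i a)) (λ a → ¬? (sameCycle? π k a))
        ((λ ¬s s′ → ¬s (sameCycle-trans π s s′)) ,
         (λ ¬s s′ → ¬s (sameCycle-trans π (sameCycle-sym π s) s′))) (leaders π))

-- Averages over the symmetric group

-- Such an `F` sees the list `cycleType w` only as a multiset, that is, as a partition.
Symmetric : (List ℕ → ℚ) → Set
Symmetric F = ∀ {μ ν} → μ ↭ ν → F μ ≡ F ν

Composition : ℕ → List ℕ → Set
Composition n μ = All (1 ≤_) μ × sum μ ≡ n

average : ∀ n → (List ℕ → ℚ) → ℚ
average n F = inv (n !) ℚ.* ∑ (permutations n) (F ∘ cycleType)
  where instance _ = n ℕ.!≢0

average-cong : ∀ n {F H : List ℕ → ℚ} → (∀ μ → F μ ≡ H μ) → average n F ≡ average n H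
average-cong n F≗H = cong (inv (n !) {{n ℕ.!≢0}} ℚ.*_) (∑-cong (permutations n) (F≗H ∘ cycleType))

average-+ : ∀ n (F H : List ℕ → ℚ) → average n (λ μ → F μ ℚ.+ H μ) ≡ average n F ℚ.+ average n H
average-+ n F H = trans (cong (c ℚ.*_) (∑-+ (permutations n) (F ∘ cycleType) (H ∘ cycleType)))
  (ℚ.*-distribˡ-+ c (∑ (permutations n) (F ∘ cycleType)) _)
  where c = inv (n !) {{n ℕ.!≢0}}

average-* : ∀ n c (F : List ℕ → ℚ) → average n (λ μ → c ℚ.* F μ) ≡ c ℚ.* average n F
average-* n c F = trans (cong (d ℚ.*_) (∑-*ˡ (permutations n) c (F ∘ cycleType)))
  (solve 3 (λ a b s → b ⊠ (a ⊠ s) := a ⊠ (b ⊠ s)) refl c d (∑ (permutations n) (F ∘ cycleType)))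
  where d = inv (n !) {{n ℕ.!≢0}}

average-∑ : ∀ n (xs : List A) (F : A → List ℕ → ℚ) →
            average n (λ μ → ∑ xs (λ x → F x μ)) ≡ ∑ xs (λ x → average n (F x))
average-∑ n xs F = trans (cong (c ℚ.*_) (∑-comm (permutations n) xs (λ w x → F x (cycleType w))))
  (sym (∑-*ˡ xs c (λ x → ∑ (permutations n) (F x ∘ cycleType))))
  where c = inv (n !) {{n ℕ.!≢0}}

average-0 : ∀ F → average 0 F ≡ F []
average-0 F = trans (ℚ.*-identityˡ _) (ℚ.+-identityʳ (F []))

average-suc : ∀ n F → ι (suc n) ℚ.* average (suc n) F ≡ average n (augment F)
average-suc n F = begin
  ι (suc n) ℚ.* (inv (suc n !) ℚ.* S)
    ≡⟨ cong (λ c → ι (suc n) ℚ.* (c ℚ.* S)) (inv-* (suc n) (n !) (suc n !) refl) ⟩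
  ι (suc n) ℚ.* (inv (suc n) ℚ.* inv (n !) ℚ.* S)
    ≡⟨ solve 4 (λ a b c s → a ⊠ ((b ⊠ c) ⊠ s) := (a ⊠ b) ⊠ (c ⊠ s)) refl (ι (suc n)) (inv (suc n)) (inv (n !)) S ⟩
  ι (suc n) ℚ.* inv (suc n) ℚ.* (inv (n !) ℚ.* S)
    ≡⟨ cong (ℚ._* (inv (n !) ℚ.* S)) (ι*inv (suc n)) ⟩
  1ℚ ℚ.* (inv (n !) ℚ.* S)
    ≡⟨ ℚ.*-identityˡ _ ⟩
  inv (n !) ℚ.* S
    ≡⟨ cong (inv (n !) ℚ.*_) (∑-cycleType-suc n F) ⟩
  average n (augment F)
    ∎
  where
  instance
    _ = n ℕ.!≢0
    _ = suc n ℕ.!≢0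
  S = ∑ (permutations (suc n)) (F ∘ cycleType)

selections-↭ : ∀ (L : List A) {y ys} → (y , ys) ∈ selections L → L ↭ y ∷ ys
selections-↭ (x ∷ L) (here refl) = ↭-refl
selections-↭ (x ∷ L) (there s) with ∈-map⁻ (λ (y , ys) → y , x ∷ ys) s
... | (y , ys) , s′ , refl = ↭-trans (prep x (selections-↭ L s′)) (swap x y ↭-refl)

augment-cong-local : ∀ {F H} → (∀ {μ} → Composition (suc n) μ → F μ ≡ H μ) →
                     ∀ {μ} → Composition n μ → augment F μ ≡ augment H μ
augment-cong-local F≗H {μ} (pos , refl) = cong₂ ℚ._+_
  (F≗H (s≤s z≤n ∷ pos , refl))
  (∑-cong-∈ (selections μ) λ {(c , r)} s → cong (ι c ℚ.*_)
    (let μ↭ = selections-↭ μ s in case All-resp-↭ μ↭ pos of λ where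
      (_ ∷ r-pos) → F≗H (s≤s z≤n ∷ r-pos , cong suc (sym (sum-↭ μ↭)))))

-- Only compositions of n occur as cycle types. This enters through `average-suc`: inserting a point
-- takes compositions of n to compositions of n + 1, so the agreement of `F` and `H` passes down to
-- their augmentations.
average-cong-local : ∀ n {F H} → (∀ {μ} → Composition n μ → F μ ≡ H μ) → average n F ≡ average n H
average-cong-local zero    {F} {H} F≗H =
  trans (average-0 F) (trans (F≗H ([] , refl)) (sym (average-0 H)))
average-cong-local (suc n) {F} {H} F≗H = ι-cancelˡ (suc n) (trans (average-suc n F) (trans
  (average-cong-local n (augment-cong-local F≗H)) (sym (average-suc n H))))

∑-selections-↭ : ∀ {μ ν : List A} → μ ↭ ν → (H : A → List A → ℚ) →
  (∀ {c r s} → r ↭ s → H c r ≡ H c s) →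
  ∑ (selections μ) (λ (c , r) → H c r) ≡ ∑ (selections ν) (λ (c , r) → H c r)
∑-selections-∷ : ∀ (x : A) μ (H : A → List A → ℚ) →
  ∑ (selections (x ∷ μ)) (λ (c , r) → H c r) ≡ H x μ ℚ.+ ∑ (selections μ) (λ (c , r) → H c (x ∷ r))
∑-selections-∷ x μ H =
  cong (H x μ ℚ.+_) (∑-map (λ (y , ys) → y , x ∷ ys) (selections μ) (λ (c , r) → H c r))

∑-selections-↭ ↭-refl H H-sym = refl
∑-selections-↭ {μ = x ∷ μ} {x ∷ ν} (prep x r) H H-sym = begin
  ∑ (selections (x ∷ μ)) (λ (c , r) → H c r)                 ≡⟨ ∑-selections-∷ x μ H ⟩
  H x μ ℚ.+ ∑ (selections μ) (λ (c , r) → H c (x ∷ r))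
    ≡⟨ cong₂ ℚ._+_ (H-sym r) (∑-selections-↭ r (λ c r → H c (x ∷ r)) (H-sym ∘ prep x)) ⟩
  H x ν ℚ.+ ∑ (selections ν) (λ (c , r) → H c (x ∷ r))       ≡⟨ ∑-selections-∷ x ν H ⟨
  ∑ (selections (x ∷ ν)) (λ (c , r) → H c r)                 ∎
∑-selections-↭ {μ = x ∷ y ∷ μ} {y ∷ x ∷ ν} (swap x y r) H H-sym = begin
  ∑ (selections (x ∷ y ∷ μ)) (λ (c , r) → H c r)
    ≡⟨ expand x y μ ⟩
  H x (y ∷ μ) ℚ.+ (H y (x ∷ μ) ℚ.+ ∑ (selections μ) (λ (c , r) → H c (x ∷ y ∷ r)))
    ≡⟨ cong₂ ℚ._+_ (H-sym (prep y r)) (cong₂ ℚ._+_ (H-sym (prep x r)) (trans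
         (∑-selections-↭ r (λ c r → H c (x ∷ y ∷ r)) (H-sym ∘ prep x ∘ prep y))
         (∑-cong (selections ν) λ _ → H-sym (swap x y ↭-refl)))) ⟩
  H x (y ∷ ν) ℚ.+ (H y (x ∷ ν) ℚ.+ ∑ (selections ν) (λ (c , r) → H c (y ∷ x ∷ r)))
    ≡⟨ solve 3 (λ a b s → a ⊞ (b ⊞ s) := b ⊞ (a ⊞ s)) refl (H x (y ∷ ν)) (H y (x ∷ ν))
         (∑ (selections ν) (λ (c , r) → H c (y ∷ x ∷ r))) ⟩
  H y (x ∷ ν) ℚ.+ (H x (y ∷ ν) ℚ.+ ∑ (selections ν) (λ (c , r) → H c (y ∷ x ∷ r)))
    ≡⟨ expand y x ν ⟨
  ∑ (selections (y ∷ x ∷ ν)) (λ (c , r) → H c r)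
    ∎
  where
  expand : ∀ x y μ → ∑ (selections (x ∷ y ∷ μ)) (λ (c , r) → H c r) ≡
    H x (y ∷ μ) ℚ.+ (H y (x ∷ μ) ℚ.+ ∑ (selections μ) (λ (c , r) → H c (x ∷ y ∷ r)))
  expand x y μ = trans (∑-selections-∷ x (y ∷ μ) H)
    (cong (H x (y ∷ μ) ℚ.+_) (∑-selections-∷ y μ (λ c r → H c (x ∷ r))))
∑-selections-↭ (↭-trans′ r s) H H-sym =
  trans (∑-selections-↭ r H H-sym) (∑-selections-↭ s H H-sym)

augment-symmetric : ∀ {F} → Symmetric F → Symmetric (augment F)
augment-symmetric {F} F-sym r = cong₂ ℚ._+_ (F-sym (prep 1 r))
  (∑-selections-↭ r (λ c r → ι c ℚ.* F (suc c ∷ r)) λ {c} s → cong (ι c ℚ.*_) (F-sym (prep (suc c) s)))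

-- The new point either enters the marked cycle of length k, in one of k places, or goes elsewhere
-- and leaves k a bystander. Symmetry moves k back to the front.
augment-∷ : ∀ {F} → Symmetric F → ∀ k μ →
            augment F (k ∷ μ) ≡ ι k ℚ.* F (suc k ∷ μ) ℚ.+ augment (F ∘ (k ∷_)) μ
augment-∷ {F} F-sym k μ = begin
  F (1 ∷ k ∷ μ) ℚ.+ ∑ (selections (k ∷ μ)) (λ (c , r) → ι c ℚ.* F (suc c ∷ r))
    ≡⟨ cong₂ ℚ._+_ (F-sym (swap 1 k ↭-refl)) (trans
         (∑-selections-∷ k μ (λ c r → ι c ℚ.* F (suc c ∷ r)))
         (cong (ι k ℚ.* F (suc k ∷ μ) ℚ.+_) (∑-cong (selections μ) λ (c , r) →
           cong (ι c ℚ.*_) (F-sym (swap (suc c) k ↭-refl))))) ⟩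
  F (k ∷ 1 ∷ μ) ℚ.+ (ι k ℚ.* F (suc k ∷ μ) ℚ.+ T)
    ≡⟨ solve 3 (λ a b t → a ⊞ (b ⊞ t) := b ⊞ (a ⊞ t)) refl (F (k ∷ 1 ∷ μ)) (ι k ℚ.* F (suc k ∷ μ)) T ⟩
  ι k ℚ.* F (suc k ∷ μ) ℚ.+ augment (F ∘ (k ∷_)) μ
    ∎
  where T = ∑ (selections μ) (λ (c , r) → ι c ℚ.* F (k ∷ suc c ∷ r))

-- Newton's identity n hₙ = Σₖ pₖ hₙ₋ₖ, stated for an arbitrary function of the
-- cycle type.
average-newton : ∀ n {F} → Symmetric F →
  ι n ℚ.* average n F ≡ ∑ (upTo n) (λ i → average i (F ∘ ((n ∸ i) ∷_)))
average-newton zero {F} F-sym = ℚ.*-zeroˡ (average 0 F)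
average-newton (suc zero) {F} F-sym = begin
  ι 1 ℚ.* average 1 F                  ≡⟨ average-suc 0 F ⟩
  average 0 (augment F)                ≡⟨ average-0 (augment F) ⟩
  F (1 ∷ []) ℚ.+ 0ℚ                    ≡⟨ cong (ℚ._+ 0ℚ) (average-0 (F ∘ (1 ∷_))) ⟨
  average 0 (F ∘ (1 ∷_)) ℚ.+ 0ℚ        ∎
-- The identity is proved after multiplication by m; cancelling m needs m ≥ 1, hence the separate
-- case of one point.
average-newton (suc m@(suc _)) {F} F-sym = ι-cancelˡ m (begin
  ι m ℚ.* (ι (suc m) ℚ.* average (suc m) F)
    ≡⟨ cong (ι m ℚ.*_) (average-suc m F) ⟩
  ι m ℚ.* average m (augment F)
    ≡⟨ average-newton m (augment-symmetric F-sym) ⟩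
  ∑ (upTo m) (λ i → average i (augment F ∘ ((m ∸ i) ∷_)))
    ≡⟨ ∑-upTo-cong m (λ i i<m → pointwise i (ℕ.<⇒≤ i<m)) ⟩
  ∑ (upTo m) (λ i → ι (m ∸ i) ℚ.* a i ℚ.+ ι (suc i) ℚ.* a (suc i))
    ≡⟨ ∑-+ (upTo m) (λ i → ι (m ∸ i) ℚ.* a i) (λ i → ι (suc i) ℚ.* a (suc i)) ⟩
  ∑ (upTo m) (λ i → ι (m ∸ i) ℚ.* a i) ℚ.+ ∑ (upTo m) (λ i → ι (suc i) ℚ.* a (suc i))
    -- Both sums are brought to the range 0, ..., m: the first gains a term with weight m - m, the
    -- second is shifted and gains a term with weight 0. The weights m - i and i then add up to m
    -- for every i.
    ≡⟨ cong₂ ℚ._+_ lower upper ⟨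
  ∑ (upTo (suc m)) (λ i → ι (m ∸ i) ℚ.* a i) ℚ.+ ∑ (upTo (suc m)) (λ i → ι i ℚ.* a i)
    ≡⟨ ∑-+ (upTo (suc m)) (λ i → ι (m ∸ i) ℚ.* a i) (λ i → ι i ℚ.* a i) ⟨
  ∑ (upTo (suc m)) (λ i → ι (m ∸ i) ℚ.* a i ℚ.+ ι i ℚ.* a i)
    ≡⟨ ∑-upTo-cong (suc m) (λ i i≤m → trans (sym (ℚ.*-distribʳ-+ (a i) (ι (m ∸ i)) (ι i)))
         (cong (ℚ._* a i) (trans (sym (ι-+ (m ∸ i) i)) (cong ι (ℕ.m∸n+n≡m (s≤s⁻¹ i≤m)))))) ⟩
  ∑ (upTo (suc m)) (λ i → ι m ℚ.* a i)
    ≡⟨ ∑-*ˡ (upTo (suc m)) (ι m) a ⟩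
  ι m ℚ.* ∑ (upTo (suc m)) a
    ∎)
  where
  a : ℕ → ℚ
  a i = average i (F ∘ ((suc m ∸ i) ∷_))
  pointwise : ∀ i → i ≤ m → average i (augment F ∘ ((m ∸ i) ∷_)) ≡
                            ι (m ∸ i) ℚ.* a i ℚ.+ ι (suc i) ℚ.* a (suc i)
  pointwise i i≤m = begin
    average i (augment F ∘ (k ∷_))
      ≡⟨ average-cong i (augment-∷ F-sym k) ⟩
    average i (λ μ → ι k ℚ.* F (suc k ∷ μ) ℚ.+ augment (F ∘ (k ∷_)) μ)
      ≡⟨ average-+ i (λ μ → ι k ℚ.* F (suc k ∷ μ)) (augment (F ∘ (k ∷_))) ⟩
    average i (λ μ → ι k ℚ.* F (suc k ∷ μ)) ℚ.+ average i (augment (F ∘ (k ∷_)))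
      ≡⟨ cong₂ ℚ._+_
           (trans (average-* i (ι k) (F ∘ (suc k ∷_)))
             (cong (λ l → ι k ℚ.* average i (F ∘ (l ∷_))) (sym (ℕ.+-∸-assoc 1 i≤m))))
           (sym (average-suc i (F ∘ (k ∷_)))) ⟩
    ι k ℚ.* a i ℚ.+ ι (suc i) ℚ.* a (suc i)
      ∎
    where k = m ∸ i
  lower : ∑ (upTo (suc m)) (λ i → ι (m ∸ i) ℚ.* a i) ≡ ∑ (upTo m) (λ i → ι (m ∸ i) ℚ.* a i)
  lower = begin
    ∑ (upTo (suc m)) (λ i → ι (m ∸ i) ℚ.* a i)
      ≡⟨ ∑-upTo-last m (λ i → ι (m ∸ i) ℚ.* a i) ⟩
    ∑ (upTo m) (λ i → ι (m ∸ i) ℚ.* a i) ℚ.+ ι (m ∸ m) ℚ.* a m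
      ≡⟨ cong (∑ (upTo m) (λ i → ι (m ∸ i) ℚ.* a i) ℚ.+_)
           (trans (cong (λ l → ι l ℚ.* a m) (ℕ.n∸n≡0 m)) (ℚ.*-zeroˡ (a m))) ⟩
    ∑ (upTo m) (λ i → ι (m ∸ i) ℚ.* a i) ℚ.+ 0ℚ
      ≡⟨ ℚ.+-identityʳ _ ⟩
    ∑ (upTo m) (λ i → ι (m ∸ i) ℚ.* a i)
      ∎
  upper : ∑ (upTo (suc m)) (λ i → ι i ℚ.* a i) ≡ ∑ (upTo m) (λ i → ι (suc i) ℚ.* a (suc i))
  upper = begin
    ∑ (upTo (suc m)) (λ i → ι i ℚ.* a i)
      ≡⟨ ∑-upTo-head m (λ i → ι i ℚ.* a i) ⟩
    0ℚ ℚ.* a 0 ℚ.+ ∑ (upTo m) (λ i → ι (suc i) ℚ.* a (suc i))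
      ≡⟨ cong (ℚ._+ ∑ (upTo m) (λ i → ι (suc i) ℚ.* a (suc i))) (ℚ.*-zeroˡ (a 0)) ⟩
    0ℚ ℚ.+ ∑ (upTo m) (λ i → ι (suc i) ℚ.* a (suc i))
      ≡⟨ ℚ.+-identityˡ _ ⟩
    ∑ (upTo m) (λ i → ι (suc i) ℚ.* a (suc i))
      ∎

-- Partitions

_↭?_ : (λs μ : List ℕ) → Dec (λs ↭ μ)
[]       ↭? []      = yes ↭-refl
[]       ↭? (k ∷ μ) = no λ r → case ↭-empty-inv (↭-sym r) of λ ()
(k ∷ ν) ↭? μ with k ∈? μ
... | no  k∉μ = no λ r → k∉μ (∈-resp-↭ r (here refl))
... | yes k∈μ with ∈-∃++ k∈μ
...   | xs , ys , refl = map′ (λ r → ↭-trans (prep k r) (↭-sym (shift k xs ys)))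
                              (λ r → drop-∷ (↭-trans r (shift k xs ys)))
                              (ν ↭? (xs ++ ys))

-- The indicator of the conjugacy class of cycle type `ν`.
δ : List ℕ → List ℕ → ℚ
δ ν μ = 𝟙 (ν ↭? μ)

δ-symmetric : ∀ ν → Symmetric (δ ν)
δ-symmetric ν {μ} {μ′} r = 𝟙-cong (ν ↭? μ) (ν ↭? μ′) (λ s → ↭-trans s r) (λ s → ↭-trans s (↭-sym r))

-- The numbers z_λ and their recursion

factor : List ℕ → ℕ → ℕ
factor μ i = i ^ multiplicity i μ * multiplicity i μ !

-- `z μ` is the case N = `sum μ`. A free bound makes the products for `μ` and `k ∷ μ` comparable
-- factor by factor.
zUpTo : List ℕ → ℕ → ℕ
zUpTo μ N = product (map (factor μ) (map suc (upTo N)))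

zUpTo-suc : ∀ μ N → zUpTo μ (suc N) ≡ zUpTo μ N * factor μ (suc N)
zUpTo-suc μ N = begin
  product (map (factor μ) (map suc (upTo (suc N))))
    ≡⟨ cong (product ∘ map (factor μ) ∘ map suc) (List.upTo-∷ʳ N) ⟨
  product (map (factor μ) (map suc (upTo N ++ N ∷ [])))
    ≡⟨ cong (product ∘ map (factor μ)) (List.map-++ suc (upTo N) (N ∷ [])) ⟩
  product (map (factor μ) (map suc (upTo N) ++ suc N ∷ []))
    ≡⟨ cong product (List.map-++ (factor μ) (map suc (upTo N)) (suc N ∷ [])) ⟩
  product (map (factor μ) (map suc (upTo N)) ++ factor μ (suc N) ∷ [])
    ≡⟨ product-++ (map (factor μ) (map suc (upTo N))) (factor μ (suc N) ∷ []) ⟩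
  zUpTo μ N * (factor μ (suc N) * 1)
    ≡⟨ cong (zUpTo μ N *_) (ℕ.*-identityʳ (factor μ (suc N))) ⟩
  zUpTo μ N * factor μ (suc N)
    ∎

multiplicity-∉ : ∀ {i μ} → ¬ i ∈ μ → multiplicity i μ ≡ 0
multiplicity-∉ {i} {μ} i∉μ = cong length (List.filter-none (i ℕ.≟_) {xs = μ}
  (All.tabulate λ x∈μ i≡x → i∉μ (subst (_∈ μ) (sym i≡x) x∈μ)))

∈⇒≤sum : ∀ {a μ} → a ∈ μ → a ≤ sum μ
∈⇒≤sum (here refl) = ℕ.m≤m+n _ _
∈⇒≤sum {μ = b ∷ _} (there a∈) = ℕ.≤-trans (∈⇒≤sum a∈) (ℕ.m≤n+m _ b)

-- No part exceeds the sum of the parts, so each further factor has multiplicity 0 and equals 1.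
zUpTo-stable : ∀ μ d → zUpTo μ (d + sum μ) ≡ z μ
zUpTo-stable μ zero    = refl
zUpTo-stable μ (suc d) = begin
  zUpTo μ (suc (d + sum μ))
    ≡⟨ zUpTo-suc μ (d + sum μ) ⟩
  zUpTo μ (d + sum μ) * factor μ (suc (d + sum μ))
    ≡⟨ cong₂ (λ a m → a * (suc (d + sum μ) ^ m * m !)) (zUpTo-stable μ d)
         (multiplicity-∉ {μ = μ} λ i∈μ → ℕ.<⇒≱ (s≤s (ℕ.m≤n+m (sum μ) d)) (∈⇒≤sum i∈μ)) ⟩
  z μ * 1
    ≡⟨ ℕ.*-identityʳ (z μ) ⟩
  z μ
    ∎

multiplicity-≡ : ∀ k μ → multiplicity k (k ∷ μ) ≡ suc (multiplicity k μ)
multiplicity-≡ k μ = cong length (List.filter-accept (k ℕ.≟_) {k} {μ} refl)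

multiplicity-≢ : ∀ {i k} μ → i ≢ k → multiplicity i (k ∷ μ) ≡ multiplicity i μ
multiplicity-≢ {i} {k} μ i≢k = cong length (List.filter-reject (i ℕ.≟_) {k} {μ} i≢k)

factor-≢ : ∀ {i k} μ → i ≢ k → factor (k ∷ μ) i ≡ factor μ i
factor-≢ {i} μ i≢k = cong (λ m → i ^ m * m !) (multiplicity-≢ μ i≢k)

factor-≡ : ∀ k μ → factor (k ∷ μ) k ≡ k * multiplicity k (k ∷ μ) * factor μ k
factor-≡ k μ rewrite multiplicity-≡ k μ =
  *-interchange k (k ^ m) (suc m) (m !)
  where
  m = multiplicity k μ

zUpTo-∷-< : ∀ k μ N → N < k → zUpTo (k ∷ μ) N ≡ zUpTo μ N
zUpTo-∷-< k μ zero    N<k = refl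
zUpTo-∷-< k μ (suc N) N<k = begin
  zUpTo (k ∷ μ) (suc N)                    ≡⟨ zUpTo-suc (k ∷ μ) N ⟩
  zUpTo (k ∷ μ) N * factor (k ∷ μ) (suc N)
    ≡⟨ cong₂ _*_ (zUpTo-∷-< k μ N (ℕ.<⇒≤ N<k)) (factor-≢ μ (ℕ.<⇒≢ N<k)) ⟩
  zUpTo μ N * factor μ (suc N)             ≡⟨ zUpTo-suc μ N ⟨
  zUpTo μ (suc N)                          ∎

zUpTo-∷ : ∀ k μ N → 1 ≤ k → k ≤ N → zUpTo (k ∷ μ) N ≡ k * multiplicity k (k ∷ μ) * zUpTo μ N
zUpTo-∷ (suc _) μ zero    1≤k ()
zUpTo-∷ k μ (suc N) 1≤k k≤1+N with ℕ.m≤n⇒m<n∨m≡n k≤1+N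
... | inj₂ refl = begin
  zUpTo (k ∷ μ) (suc N)                    ≡⟨ zUpTo-suc (k ∷ μ) N ⟩
  zUpTo (k ∷ μ) N * factor (k ∷ μ) k       ≡⟨ cong₂ _*_ (zUpTo-∷-< k μ N ℕ.≤-refl) (factor-≡ k μ) ⟩
  zUpTo μ N * (c * factor μ k)             ≡⟨ ℕ.*-comm (zUpTo μ N) _ ⟩
  c * factor μ k * zUpTo μ N               ≡⟨ ℕ.*-assoc c (factor μ k) (zUpTo μ N) ⟩
  c * (factor μ k * zUpTo μ N)             ≡⟨ cong (c *_) (ℕ.*-comm (factor μ k) (zUpTo μ N)) ⟩
  c * (zUpTo μ N * factor μ k)             ≡⟨ cong (c *_) (zUpTo-suc μ N) ⟨
  c * zUpTo μ (suc N)                      ∎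
  where c = k * multiplicity k (k ∷ μ)
... | inj₁ (s≤s k≤N) = begin
  zUpTo (k ∷ μ) (suc N)                    ≡⟨ zUpTo-suc (k ∷ μ) N ⟩
  zUpTo (k ∷ μ) N * factor (k ∷ μ) (suc N)
    ≡⟨ cong₂ _*_ (zUpTo-∷ k μ N 1≤k k≤N) (factor-≢ μ (ℕ.<⇒≢ (s≤s k≤N) ∘ sym)) ⟩
  c * zUpTo μ N * factor μ (suc N)         ≡⟨ ℕ.*-assoc c (zUpTo μ N) (factor μ (suc N)) ⟩
  c * (zUpTo μ N * factor μ (suc N))       ≡⟨ cong (c *_) (zUpTo-suc μ N) ⟨
  c * zUpTo μ (suc N)                      ∎
  where c = k * multiplicity k (k ∷ μ)

-- With the common bound k + `sum μ`, the two products differ only in the factor belonging to k.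
z-∷ : ∀ {k} μ → 1 ≤ k → z (k ∷ μ) ≡ k * multiplicity k (k ∷ μ) * z μ
z-∷ {k} μ 1≤k = trans (zUpTo-∷ k μ (k + sum μ) 1≤k (ℕ.m≤m+n k (sum μ)))
  (cong (k * multiplicity k (k ∷ μ) *_) (zUpTo-stable μ k))

multiplicity-↭ : ∀ {μ ν} → μ ↭ ν → ∀ i → multiplicity i μ ≡ multiplicity i ν
multiplicity-↭ r i = ↭-length (filter-↭ (i ℕ.≟_) r)

z-↭ : ∀ {μ ν} → μ ↭ ν → z μ ≡ z ν
z-↭ {μ} {ν} r = trans (cong (zUpTo μ) (sum-↭ r))
  (cong product (List.map-cong (λ i → cong (λ m → i ^ m * m !) (multiplicity-↭ r i)) (map suc (upTo (sum ν)))))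

z⁻¹-remove : ∀ {k μ ν} → ν ↭ k ∷ μ → 1 ≤ k → ι (k * multiplicity k ν) ℚ.* z⁻¹ ν ≡ z⁻¹ μ
z⁻¹-remove {k} {μ} {ν} r 1≤k = inv-unique (z μ) {{z≢0 μ}} (begin
  ι (z μ) ℚ.* (ι c ℚ.* z⁻¹ ν)     ≡⟨ solve 3 (λ a b d → a ⊠ (b ⊠ d) := (b ⊠ a) ⊠ d) refl (ι (z μ)) (ι c) (z⁻¹ ν) ⟩
  ι c ℚ.* ι (z μ) ℚ.* z⁻¹ ν       ≡⟨ cong (ℚ._* z⁻¹ ν) (ι-* c (z μ)) ⟨
  ι (c * z μ) ℚ.* z⁻¹ ν           ≡⟨ cong (λ m → ι m ℚ.* z⁻¹ ν) c*zμ≡zν ⟩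
  ι (z ν) ℚ.* z⁻¹ ν               ≡⟨ ι*inv (z ν) {{z≢0 ν}} ⟩
  1ℚ                              ∎)
  where
  c = k * multiplicity k ν
  c*zμ≡zν : c * z μ ≡ z ν
  c*zμ≡zν = trans (cong (λ m → k * m * z μ) (multiplicity-↭ r k)) (trans (sym (z-∷ μ 1≤k)) (sym (z-↭ r)))

-- The size of a partition as Σ k m_k. The index j stands for the part k = j + 1, and `sum μ ≤ n`
-- guarantees that every part is met.
∑-parts : ∀ n μ → All (1 ≤_) μ → sum μ ≤ n →
          ∑ (upTo n) (λ j → ι (suc j * multiplicity (suc j) μ)) ≡ ι (sum μ)
∑-parts n []      pos sum≤n = ∑-zero (upTo n) λ {j} _ → cong ι (ℕ.*-zeroʳ (suc j))
∑-parts n (suc k ∷ μ) (_ ∷ pos) sum≤n = begin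
  ∑ (upTo n) (λ j → ι (suc j * multiplicity (suc j) (suc k ∷ μ)))
    ≡⟨ ∑-cong (upTo n) split ⟩
  ∑ (upTo n) (λ j → e j ℚ.+ ι (suc j * multiplicity (suc j) μ))
    ≡⟨ ∑-+ (upTo n) e (λ j → ι (suc j * multiplicity (suc j) μ)) ⟩
  ∑ (upTo n) e ℚ.+ ∑ (upTo n) (λ j → ι (suc j * multiplicity (suc j) μ))
    ≡⟨ cong₂ ℚ._+_
         (trans (∑-unique (Unique.upTo⁺ n) (∈-upTo⁺ (ℕ.m+n≤o⇒m≤o (suc k) sum≤n)) λ {j} _ j≢k →
             trans (cong (ι (suc j) ℚ.*_) (𝟙-no (suc j ℕ.≟ suc k) (j≢k ∘ ℕ.suc-injective))) (ℚ.*-zeroʳ (ι (suc j))))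
           (trans (cong (ι (suc k) ℚ.*_) (𝟙-yes (suc k ℕ.≟ suc k) refl)) (ℚ.*-identityʳ (ι (suc k)))))
         (∑-parts n μ pos (ℕ.m+n≤o⇒n≤o (suc k) sum≤n)) ⟩
  ι (suc k) ℚ.+ ι (sum μ)
    ≡⟨ ι-+ (suc k) (sum μ) ⟨
  ι (sum (suc k ∷ μ))
    ∎
  where
  e : ℕ → ℚ
  e j = ι (suc j) ℚ.* 𝟙 (suc j ℕ.≟ suc k)
  split : ∀ j → ι (suc j * multiplicity (suc j) (suc k ∷ μ)) ≡ e j ℚ.+ ι (suc j * multiplicity (suc j) μ)
  split j = case suc j ℕ.≟ suc k of λ where
    (yes refl) → begin
      ι (suc j * multiplicity (suc j) (suc j ∷ μ))
        ≡⟨ cong (λ m → ι (suc j * m)) (multiplicity-≡ (suc j) μ) ⟩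
      ι (suc j * suc (multiplicity (suc j) μ))
        ≡⟨ cong ι (ℕ.*-suc (suc j) (multiplicity (suc j) μ)) ⟩
      ι (suc j + suc j * multiplicity (suc j) μ)
        ≡⟨ ι-+ (suc j) (suc j * multiplicity (suc j) μ) ⟩
      ι (suc j) ℚ.+ ι (suc j * multiplicity (suc j) μ)
        ≡⟨ cong (ℚ._+ ι (suc j * multiplicity (suc j) μ)) (trans
             (cong (ι (suc j) ℚ.*_) (𝟙-yes (suc j ℕ.≟ suc k) refl)) (ℚ.*-identityʳ (ι (suc j)))) ⟨
      e j ℚ.+ ι (suc j * multiplicity (suc j) μ)
        ∎
    (no j≢k) → begin
      ι (suc j * multiplicity (suc j) (suc k ∷ μ))
        ≡⟨ cong (λ m → ι (suc j * m)) (multiplicity-≢ μ j≢k) ⟩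
      ι (suc j * multiplicity (suc j) μ)
        ≡⟨ ℚ.+-identityˡ _ ⟨
      0ℚ ℚ.+ ι (suc j * multiplicity (suc j) μ)
        ≡⟨ cong (ℚ._+ ι (suc j * multiplicity (suc j) μ)) (trans
             (cong (ι (suc j) ℚ.*_) (𝟙-no (suc j ℕ.≟ suc k) j≢k)) (ℚ.*-zeroʳ (ι (suc j)))) ⟨
      e j ℚ.+ ι (suc j * multiplicity (suc j) μ)
        ∎

-- Strong induction through Newton's identity. The term for k is the frequency of `ν` with one part
-- k removed, or 0 if k is not a part of `ν`; either way it equals k m_k / z_ν. As the k m_k add up
-- to n, the sum is n / z_ν.
average-δ : ∀ n ν → Composition n ν → average n (δ ν) ≡ z⁻¹ ν
average-δ = <-rec _ step
  where
  step : ∀ n → (∀ {i} → i < n → ∀ ν → Composition i ν → average i (δ ν) ≡ z⁻¹ ν) →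
         ∀ ν → Composition n ν → average n (δ ν) ≡ z⁻¹ ν
  step zero    rec []      comp = refl
  step zero    rec (_ ∷ _) (s≤s _ ∷ _ , ())
  step n@(suc m) rec ν (pos , sum≡n) = ι-cancelˡ n (begin
    ι n ℚ.* average n (δ ν)
      ≡⟨ average-newton n (δ-symmetric ν) ⟩
    ∑ (upTo n) (λ i → average i (δ ν ∘ ((n ∸ i) ∷_)))
      ≡⟨ ∑-upTo-cong n remove-part ⟩
    ∑ (upTo n) (λ i → ι ((n ∸ i) * multiplicity (n ∸ i) ν) ℚ.* z⁻¹ ν)
      ≡⟨ ∑-*ʳ (upTo n) (z⁻¹ ν) (λ i → ι ((n ∸ i) * multiplicity (n ∸ i) ν)) ⟩
    ∑ (upTo n) (λ i → ι ((n ∸ i) * multiplicity (n ∸ i) ν)) ℚ.* z⁻¹ ν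
      ≡⟨ cong (ℚ._* z⁻¹ ν) (trans
           (∑-upTo-cong n λ i i<n → cong (λ k → ι (k * multiplicity k ν)) (ℕ.+-∸-assoc 1 (s≤s⁻¹ i<n)))
           (∑-upTo-reverse m (λ j → ι (suc j * multiplicity (suc j) ν)))) ⟩
    ∑ (upTo n) (λ j → ι (suc j * multiplicity (suc j) ν)) ℚ.* z⁻¹ ν
      ≡⟨ cong (ℚ._* z⁻¹ ν) (trans (∑-parts n ν pos (ℕ.≤-reflexive sum≡n)) (cong ι sum≡n)) ⟩
    ι n ℚ.* z⁻¹ ν
      ∎)
    where
    remove-part : ∀ i → i < n → average i (δ ν ∘ ((n ∸ i) ∷_)) ≡
                                ι ((n ∸ i) * multiplicity (n ∸ i) ν) ℚ.* z⁻¹ ν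
    remove-part i i<n = case k ∈? ν of λ where
        (no k∉ν) → begin
          average i (δ ν ∘ (k ∷_))
            ≡⟨ average-cong i (λ μ → trans
                 (𝟙-no (ν ↭? (k ∷ μ)) (λ r → k∉ν (∈-resp-↭ (↭-sym r) (here refl))))
                 (sym (ℚ.*-zeroˡ 0ℚ))) ⟩
          -- Zero is written as 0 · 0 so that `average-*` can extract a factor 0.
          average i (λ _ → 0ℚ ℚ.* 0ℚ)
            ≡⟨ average-* i 0ℚ (λ _ → 0ℚ) ⟩
          0ℚ ℚ.* average i (λ _ → 0ℚ)
            ≡⟨ ℚ.*-zeroˡ (average i (λ _ → 0ℚ)) ⟩
          0ℚ
            ≡⟨ ℚ.*-zeroˡ (z⁻¹ ν) ⟨
          0ℚ ℚ.* z⁻¹ ν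
            ≡⟨ cong (λ m → ι m ℚ.* z⁻¹ ν) (trans (cong (k *_) (multiplicity-∉ k∉ν)) (ℕ.*-zeroʳ k)) ⟨
          ι (k * multiplicity k ν) ℚ.* z⁻¹ ν
            ∎
        (yes k∈ν) → case ∈-∃++ k∈ν of λ where
          (xs , ys , ν≡) → found (xs ++ ys) (↭-trans (↭-reflexive ν≡) (shift k xs ys))
      where
      k = n ∸ i
      found : ∀ μ → ν ↭ k ∷ μ → average i (δ ν ∘ (k ∷_)) ≡ ι (k * multiplicity k ν) ℚ.* z⁻¹ ν
      found μ r = begin
        average i (δ ν ∘ (k ∷_))
          ≡⟨ average-cong i (λ κ → 𝟙-cong (ν ↭? (k ∷ κ)) (μ ↭? κ)
               (λ s → drop-∷ (↭-trans (↭-sym r) s)) (λ s → ↭-trans r (prep k s))) ⟩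
        average i (δ μ)
          ≡⟨ rec i<n μ (All.tail pos′ , ℕ.+-cancelˡ-≡ k (sum μ) i
               (trans (sym (sum-↭ r)) (trans sum≡n (sym (ℕ.m∸n+n≡m (ℕ.<⇒≤ i<n)))))) ⟩
        z⁻¹ μ
          ≡⟨ z⁻¹-remove r (All.head pos′) ⟨
        ι (k * multiplicity k ν) ℚ.* z⁻¹ ν
          ∎
        where pos′ = All-resp-↭ r pos

-- Partitions as representatives of cycle types

toList-injective : ∀ {u v : Vec A n} → toList u ≡ toList v → u ≡ v
toList-injective {u = []}    {[]}    eq = refl
toList-injective {u = x ∷ u} {y ∷ v} eq =
  cong₂ _∷_ (List.∷-injectiveˡ eq) (toList-injective (List.∷-injectiveʳ eq))

words-unique : ∀ k n → Unique (words k n)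
words-unique k zero    = [] AllPairs.∷ AllPairs.[]
words-unique k (suc n) = Unique.cartesianProductWith⁺ _∷_ Vec.∷-injective
  (Unique.map⁺ ℕ.suc-injective (Unique.upTo⁺ k)) (words-unique k n)

partitions-unique : ∀ n → Unique (partitions n)
partitions-unique n = Unique.filter⁺ (isPartitionOf? n) (Unique.concat⁺
  (All.map⁺ (All.universal (λ l → Unique.map⁺ toList-injective (words-unique n l)) (upTo (suc n))))
  (AllPairs.map⁺ (AllPairs.map disjoint (Unique.upTo⁺ (suc n)))))
  where
  disjoint : ∀ {l m} → l ≢ m → Disjoint (map toList (words n l)) (map toList (words n m))
  disjoint l≢m (∈l , ∈m) with ∈-map⁻ toList ∈l | ∈-map⁻ toList ∈m
  ... | u , _ , refl | v , _ , eq =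
    l≢m (trans (sym (Vec.length-toList u)) (trans (cong length eq) (Vec.length-toList v)))

partition-rearranging : ∀ {n μ} → Composition n μ → ∃ λ ν → ν ∈ partitions n × ν ↭ μ
partition-rearranging {n} {μ} (pos , sum≡n) = ν , ∈-partitions (isPartitionOf
    (Decreasing.sort-↗ μ) (All-resp-↭ (↭-sym ν↭μ) pos) (trans (sum-↭ ν↭μ) sum≡n)) , ν↭μ
  where
  ν = Decreasing.sort μ
  ν↭μ = Decreasing.sort-↭ μ

∈-partitions⁻ : ∀ n {μ} → μ ∈ partitions n → IsPartitionOf n μ
∈-partitions⁻ n μ∈ = proj₂ (∈-filter⁻ (isPartitionOf? n)
  {xs = List.concatMap (λ l → map toList (words n l)) (upTo (suc n))} μ∈)

partitions-separated : ∀ n {μ ν} → μ ∈ partitions n → ν ∈ partitions n → μ ↭ ν → μ ≡ ν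
partitions-separated n μ∈ ν∈ r = Pointwise-≡⇒≡ (Sorted.↗↭↗⇒≋ (Flip.totalOrder ℕ.≤-totalOrder)
  (IsPartitionOf.decreasing (∈-partitions⁻ n μ∈))
  (IsPartitionOf.decreasing (∈-partitions⁻ n ν∈)) (↭⇒↭ₛ r))

-- Exactly one partition rearranges to a given composition, so on compositions `F` is the
-- combination of the indicators `δ ν` with coefficients `F ν`. Averaging is linear.
average-partitions : ∀ n {F} → Symmetric F → average n F ≡ ∑ (partitions n) (λ ν → z⁻¹ ν ℚ.* F ν)
average-partitions n {F} F-sym = begin
  average n F
    ≡⟨ average-cong-local n expand ⟩
  average n (λ μ → ∑ (partitions n) λ ν → F ν ℚ.* δ ν μ)
    ≡⟨ average-∑ n (partitions n) (λ ν μ → F ν ℚ.* δ ν μ) ⟩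
  ∑ (partitions n) (λ ν → average n (λ μ → F ν ℚ.* δ ν μ))
    ≡⟨ ∑-cong-∈ (partitions n) (λ {ν} ν∈ → trans (average-* n (F ν) (δ ν)) (trans
         (cong (F ν ℚ.*_) (average-δ n ν (composition ν∈))) (ℚ.*-comm (F ν) (z⁻¹ ν)))) ⟩
  ∑ (partitions n) (λ ν → z⁻¹ ν ℚ.* F ν)
    ∎
  where
  composition : ∀ {ν} → ν ∈ partitions n → Composition n ν
  composition {ν} ν∈ with ∈-partitions⁻ n ν∈
  ... | isPartitionOf _ pos total = pos , total
  expand : ∀ {μ} → Composition n μ → F μ ≡ ∑ (partitions n) λ ν → F ν ℚ.* δ ν μ
  expand {μ} comp with partition-rearranging comp
  ... | ν , ν∈ , r = sym (begin
    ∑ (partitions n) (λ κ → F κ ℚ.* δ κ μ)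
      ≡⟨ ∑-unique (partitions-unique n) ν∈ (λ {κ} κ∈ κ≢ν → trans
           (cong (F κ ℚ.*_) (𝟙-no (κ ↭? μ) λ s → κ≢ν (partitions-separated n κ∈ ν∈ (↭-trans s (↭-sym r)))))
           (ℚ.*-zeroʳ (F κ))) ⟩
    F ν ℚ.* δ ν μ
      ≡⟨ cong (F ν ℚ.*_) (𝟙-yes (ν ↭? μ) r) ⟩
    F ν ℚ.* 1ℚ
      ≡⟨ ℚ.*-identityʳ (F ν) ⟩
    F ν
      ≡⟨ F-sym r ⟩
    F μ
      ∎)

-- Parking functions fixed by a permutation

∑-const : ∀ n c → ∑ (upTo n) (λ _ → c) ≡ ι n ℚ.* c
∑-const zero    c = sym (ℚ.*-zeroˡ c)
∑-const (suc n) c = begin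
  ∑ (upTo (suc n)) (λ _ → c)        ≡⟨ ∑-upTo-head n (λ _ → c) ⟩
  c ℚ.+ ∑ (upTo n) (λ _ → c)        ≡⟨ cong₂ ℚ._+_ (sym (ℚ.*-identityˡ c)) (∑-const n c) ⟩
  1ℚ ℚ.* c ℚ.+ ι n ℚ.* c            ≡⟨ ℚ.*-distribʳ-+ c 1ℚ (ι n) ⟨
  (1ℚ ℚ.+ ι n) ℚ.* c                ≡⟨ cong (ℚ._* c) (ι-+ 1 n) ⟨
  ι (suc n) ℚ.* c                   ∎

-- Words and rotation of the alphabet

Letters : ℕ → Vec ℕ ℓ → Set
Letters k v = All (λ a → 1 ≤ a × a ≤ k) (toList v)

∈-words⁻ : ∀ k m {v : Vec ℕ m} → v ∈ words k m → Letters k v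
∈-words⁻ k zero    {[]} v∈ = []
∈-words⁻ k (suc m) v∈ with ∈-cartesianProductWith⁻ _∷_ (map suc (upTo k)) (words k m) v∈
... | a , v , a∈ , v∈′ , refl with ∈-map⁻ suc a∈
...   | i , i∈ , refl = (s≤s z≤n , ∈-upTo⁻ i∈) ∷ ∈-words⁻ k m v∈′

∑-words-suc : ∀ k m (f : Vec ℕ (suc m) → ℚ) →
  ∑ (words k (suc m)) f ≡ ∑ (upTo k) (λ i → ∑ (words k m) (λ v → f (suc i ∷ v)))
∑-words-suc k m f = trans (∑-cartesianProductWith _∷_ (map suc (upTo k)) (words k m) f)
  (∑-map suc (upTo k) (λ a → ∑ (words k m) (λ v → f (a ∷ v))))

-- Parking functions are listed among the words in n letters, whereas rotation acts on words in n +
-- 1 letters. This passes between the two ranges.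
∑-words-restrict : ∀ k m (f : Vec ℕ m → ℚ) → (∀ {v} → suc k ∈ toList v → f v ≡ 0ℚ) →
                   ∑ (words (suc k) m) f ≡ ∑ (words k m) f
∑-words-restrict k zero    f f≡0 = refl
∑-words-restrict k (suc m) f f≡0 = begin
  ∑ (words (suc k) (suc m)) f
    ≡⟨ ∑-words-suc (suc k) m f ⟩
  ∑ (upTo (suc k)) (λ i → ∑ (words (suc k) m) (λ v → f (suc i ∷ v)))
    ≡⟨ ∑-upTo-last k (λ i → ∑ (words (suc k) m) (λ v → f (suc i ∷ v))) ⟩
  ∑ (upTo k) (λ i → ∑ (words (suc k) m) (λ v → f (suc i ∷ v))) ℚ.+
  ∑ (words (suc k) m) (λ v → f (suc k ∷ v))
    ≡⟨ cong₂ ℚ._+_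
         (∑-cong (upTo k) λ i → ∑-words-restrict k m (λ v → f (suc i ∷ v)) (f≡0 ∘ there))
         (∑-zero (words (suc k) m) λ _ → f≡0 (here refl)) ⟩
  ∑ (upTo k) (λ i → ∑ (words k m) (λ v → f (suc i ∷ v))) ℚ.+ 0ℚ
    ≡⟨ ℚ.+-identityʳ _ ⟩
  ∑ (upTo k) (λ i → ∑ (words k m) (λ v → f (suc i ∷ v)))
    ≡⟨ ∑-words-suc k m f ⟨
  ∑ (words k (suc m)) f
    ∎

-- The letters are 1, …, N; the value at 0 is junk.
rotateLetter : ℕ → ℕ → ℕ
rotateLetter N zero          = zero
rotateLetter N (suc zero)    = N
rotateLetter N (suc (suc a)) = suc a

rotate : ℕ → Vec ℕ ℓ → Vec ℕ ℓ
rotate N = Vec.map (rotateLetter N)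

∑-words-rotate : ∀ n m (f : Vec ℕ m → ℚ) →
                 ∑ (words (suc n) m) (f ∘ rotate (suc n)) ≡ ∑ (words (suc n) m) f
∑-words-rotate n zero    f = refl
∑-words-rotate n (suc m) f = begin
  ∑ (words (suc n) (suc m)) (f ∘ rotate (suc n))
    ≡⟨ ∑-words-suc (suc n) m (f ∘ rotate (suc n)) ⟩
  ∑ (upTo (suc n)) (λ i → ∑ (words (suc n) m) (λ v → f (rotateLetter (suc n) (suc i) ∷ rotate (suc n) v)))
    ≡⟨ ∑-cong (upTo (suc n)) (λ i → ∑-words-rotate n m (λ v → f (rotateLetter (suc n) (suc i) ∷ v))) ⟩
  ∑ (upTo (suc n)) (g ∘ rotateLetter (suc n) ∘ suc)
    -- The letter 1 goes to n + 1 and every other letter down by one, so rotation of the first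
    -- letter only moves the first summand to the end.
    ≡⟨ ∑-upTo-head n (g ∘ rotateLetter (suc n) ∘ suc) ⟩
  g (suc n) ℚ.+ ∑ (upTo n) (g ∘ suc)
    ≡⟨ ℚ.+-comm (g (suc n)) _ ⟩
  ∑ (upTo n) (g ∘ suc) ℚ.+ g (suc n)
    ≡⟨ ∑-upTo-last n (g ∘ suc) ⟨
  ∑ (upTo (suc n)) (g ∘ suc)
    ≡⟨ ∑-words-suc (suc n) m f ⟨
  ∑ (words (suc n) (suc m)) f
    ∎
  where
  g : ℕ → ℚ
  g a = ∑ (words (suc n) m) (λ v → f (a ∷ v))

rotateLetter-injective : ∀ {N a b} → 1 ≤ a × a ≤ N → 1 ≤ b × b ≤ N →
                         rotateLetter N a ≡ rotateLetter N b → a ≡ b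
rotateLetter-injective {a = suc zero}    {suc zero}    _         _         eq   = refl
rotateLetter-injective {a = suc zero}    {suc (suc b)} _         (_ , b≤N) refl = contradiction b≤N (ℕ.<⇒≱ ℕ.≤-refl)
rotateLetter-injective {a = suc (suc a)} {suc zero}    (_ , a≤N) _         refl = contradiction a≤N (ℕ.<⇒≱ ℕ.≤-refl)
rotateLetter-injective {a = suc (suc a)} {suc (suc b)} _         _         refl = refl

-- Counting the words fixed by a permutation

fixed? : ∀ (w : Permutation′ n) v → Dec (v ≡ w · v)
fixed? w v = Vec.≡-dec ℕ._≟_ v (w · v)

-- The action reads positions through the inverse of w; evaluation at the image of i turns this into
-- constancy along the steps of w.
fixed⁻ : ∀ (w : Permutation′ n) {v} → v ≡ w · v → ∀ i → lookup v (w ⟨$⟩ʳ i) ≡ lookup v i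
fixed⁻ w {v} eq i = begin
  lookup v (w ⟨$⟩ʳ i)             ≡⟨ cong (λ u → lookup u (w ⟨$⟩ʳ i)) eq ⟩
  lookup (w · v) (w ⟨$⟩ʳ i)       ≡⟨ Vec.lookup∘tabulate _ (w ⟨$⟩ʳ i) ⟩
  lookup v (w ⟨$⟩ˡ (w ⟨$⟩ʳ i))    ≡⟨ cong (lookup v) (Perm.inverseˡ w) ⟩
  lookup v i                      ∎

fixed⁺ : ∀ (w : Permutation′ n) {v} → (∀ i → lookup v (w ⟨$⟩ʳ i) ≡ lookup v i) → v ≡ w · v
fixed⁺ w {v} h = trans (sym (Vec.tabulate∘lookup v)) (Vec.tabulate-cong λ i →
  trans (cong (lookup v) (sym (Perm.inverseʳ w))) (h (w ⟨$⟩ˡ i)))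

lookup-letter : ∀ {k} {v : Vec ℕ ℓ} → Letters k v → ∀ i → 1 ≤ lookup v i × lookup v i ≤ k
lookup-letter {v = a ∷ v} (l ∷ ls) Fin.zero    = l
lookup-letter {v = a ∷ v} (l ∷ ls) (Fin.suc i) = lookup-letter ls i

-- A letterwise map preserves constancy along the steps of w, and an injective one also reflects it.
fixed-rotate : ∀ {N} (w : Permutation′ n) {v} → Letters N v →
               𝟙 (fixed? w (rotate N v)) ≡ 𝟙 (fixed? w v)
fixed-rotate {N = N} w {v} ls = 𝟙-cong (fixed? w (rotate N v)) (fixed? w v)
  (λ eq → fixed⁺ w λ i → rotateLetter-injective (lookup-letter ls (w ⟨$⟩ʳ i)) (lookup-letter ls i)
    (trans (sym (Vec.lookup-map (w ⟨$⟩ʳ i) (rotateLetter N) v))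
      (trans (fixed⁻ w eq i) (Vec.lookup-map i (rotateLetter N) v))))
  (λ eq → fixed⁺ w λ i → trans (Vec.lookup-map (w ⟨$⟩ʳ i) (rotateLetter N) v)
    (trans (cong (rotateLetter N) (fixed⁻ w eq i)) (sym (Vec.lookup-map i (rotateLetter N) v))))

length-filter-¬ : ∀ {P : A → Set} (P? : Decidable P) {xs x} → Unique xs → x ∈ xs → P x →
  (∀ {y} → y ∈ xs → P y → x ≡ y) → length xs ≡ suc (length (filter (λ y → ¬? (P? y)) xs))
length-filter-¬ P? {x ∷ xs} (x∉ ∷ _) (here refl) Px only = cong suc (sym (trans
  (cong length (List.filter-reject (λ y → ¬? (P? y)) {x} {xs} (λ ¬Px → ¬Px Px)))
  (cong length (List.filter-all (λ y → ¬? (P? y)) (All.tabulate λ {y} y∈ Py →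
    All.lookup x∉ y∈ (only (there y∈) Py))))))
length-filter-¬ P? {y ∷ xs} (y∉ ∷ u) (there x∈) Px only = cong suc (trans
  (length-filter-¬ P? u x∈ Px (only ∘ there))
  (cong length (sym (List.filter-accept (λ y → ¬? (P? y)) {y} {xs} λ Py →
    All.lookup y∉ x∈ (sym (only (here refl) Py))))))

length-insert-suc : ∀ (π : Permutation′ n) k →
                    length (cycleType (insert π (Fin.suc k))) ≡ length (cycleType π)
length-insert-suc π k = begin
  length (cycleType (insert π (Fin.suc k)))
    ≡⟨ cong length (InsertIntoCycle.cycleType-insert π k) ⟩
  suc (length (map (cycleLength π) (leadersOutside π k)))
    ≡⟨ cong suc (List.length-map (cycleLength π) (leadersOutside π k)) ⟩
  suc (length (leadersOutside π k))
    ≡⟨ outside (leader π k) ⟨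
  length (leaders π)
    ≡⟨ List.length-map (cycleLength π) (leaders π) ⟨
  length (cycleType π)
    ∎
  where
  outside : ∃ (λ i → i ∈ leaders π × SameCycle π i k) →
            length (leaders π) ≡ suc (length (leadersOutside π k))
  outside (i , i∈ , s) = length-filter-¬ (sameCycle? π k) (leaders-unique π) i∈ (sameCycle-sym π s)
    λ j∈ s′ → leaders-separated π i∈ j∈ (sameCycle-trans π s s′)

fixed-insert-zero : ∀ (π : Permutation′ n) a v → 𝟙 (fixed? (insert π Fin.zero) (a ∷ v)) ≡ 𝟙 (fixed? π v)
fixed-insert-zero π a v = 𝟙-cong (fixed? (insert π Fin.zero) (a ∷ v)) (fixed? π v)
  (λ eq → fixed⁺ π λ i → fixed⁻ (insert π Fin.zero) eq (Fin.suc i))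
  (λ eq → fixed⁺ (insert π Fin.zero) λ where
    Fin.zero    → refl
    (Fin.suc i) → fixed⁻ π eq i)

-- The new point precedes k in its cycle and must carry the same letter as k. Its letter is thus
-- forced, whereas a new fixed point chooses its letter freely; this is why only new cycles multiply
-- the count by q.
fixed-insert-suc : ∀ (π : Permutation′ n) k a v →
  𝟙 (fixed? (insert π (Fin.suc k)) (a ∷ v)) ≡ 𝟙 (fixed? π v) ℚ.* 𝟙 (lookup v k ℕ.≟ a)
fixed-insert-suc π k a v = trans
  (𝟙-cong (fixed? σ (a ∷ v)) (fixed? π v ×-dec (lookup v k ℕ.≟ a)) to from)
  (𝟙-× (fixed? π v) (lookup v k ℕ.≟ a))
  where
  open InsertIntoCycle π k using (σ; step-suc-≡; step-suc-≢)
  to : a ∷ v ≡ σ · (a ∷ v) → v ≡ π · v × lookup v k ≡ a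
  to eq = fixed⁺ π step , fixed⁻ σ eq Fin.zero
    where
    step : ∀ i → lookup v (π ⟨$⟩ʳ i) ≡ lookup v i
    step i = case π ⟨$⟩ʳ i Fin.≟ k of λ where
      (yes πi≡k) → trans (cong (lookup v) πi≡k) (trans (fixed⁻ σ eq Fin.zero)
        (trans (cong (lookup (a ∷ v)) (sym (step-suc-≡ πi≡k))) (fixed⁻ σ eq (Fin.suc i))))
      (no πi≢k)  → trans (cong (lookup (a ∷ v)) (sym (step-suc-≢ πi≢k))) (fixed⁻ σ eq (Fin.suc i))
  from : v ≡ π · v × lookup v k ≡ a → a ∷ v ≡ σ · (a ∷ v)
  from (eq , vk≡a) = fixed⁺ σ step
    where
    step : ∀ i → lookup (a ∷ v) (σ ⟨$⟩ʳ i) ≡ lookup (a ∷ v) i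
    step Fin.zero    = vk≡a
    step (Fin.suc i) = case π ⟨$⟩ʳ i Fin.≟ k of λ where
      (yes πi≡k) → trans (cong (lookup (a ∷ v)) (step-suc-≡ πi≡k))
        (trans (sym vk≡a) (trans (cong (lookup v) (sym πi≡k)) (fixed⁻ π eq i)))
      (no πi≢k)  → trans (cong (lookup (a ∷ v)) (step-suc-≢ πi≢k)) (fixed⁻ π eq i)

∑-letter : ∀ q {b} → 1 ≤ b × b ≤ q → ∑ (upTo q) (λ i → 𝟙 (b ℕ.≟ suc i)) ≡ 1ℚ
∑-letter q {suc b} (_ , b<q) = trans
  (∑-unique (Unique.upTo⁺ q) (∈-upTo⁺ b<q) λ {i} _ i≢b →
    𝟙-no (suc b ℕ.≟ suc i) (i≢b ∘ sym ∘ ℕ.suc-injective))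
  (𝟙-yes (suc b ℕ.≟ suc b) refl)

FixedWordCount : ℕ → Permutation′ n → Set
FixedWordCount {n} q w = ∑ (words q n) (λ v → 𝟙 (fixed? w v)) ≡ ι (q ^ length (cycleType w))

fixedWordCount-insert-zero : ∀ q (π : Permutation′ n) → FixedWordCount q π → FixedWordCount q (insert π Fin.zero)
fixedWordCount-insert-zero {n} q π hyp = begin
  ∑ (words q (suc n)) (λ v → 𝟙 (fixed? σ v))
    ≡⟨ ∑-words-suc q n (λ v → 𝟙 (fixed? σ v)) ⟩
  ∑ (upTo q) (λ i → ∑ (words q n) (λ v → 𝟙 (fixed? σ (suc i ∷ v))))
    ≡⟨ ∑-cong (upTo q) (λ i → ∑-cong (words q n) (fixed-insert-zero π (suc i))) ⟩
  ∑ (upTo q) (λ _ → ∑ (words q n) (λ v → 𝟙 (fixed? π v)))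
    ≡⟨ ∑-const q (∑ (words q n) (λ v → 𝟙 (fixed? π v))) ⟩
  ι q ℚ.* ∑ (words q n) (λ v → 𝟙 (fixed? π v))
    ≡⟨ cong (ι q ℚ.*_) hyp ⟩
  ι q ℚ.* ι (q ^ length (cycleType π))
    ≡⟨ ι-* q (q ^ length (cycleType π)) ⟨
  ι (q ^ suc (length (cycleType π)))
    ≡⟨ cong (λ μ → ι (q ^ length μ)) (InsertFixedPoint.cycleType-insert π) ⟨
  ι (q ^ length (cycleType σ))
    ∎
  where σ = insert π Fin.zero

fixedWordCount-insert-suc : ∀ q (π : Permutation′ n) k → FixedWordCount q π → FixedWordCount q (insert π (Fin.suc k))
fixedWordCount-insert-suc {n} q π k hyp = begin
  ∑ (words q (suc n)) (λ v → 𝟙 (fixed? σ v))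
    ≡⟨ ∑-words-suc q n (λ v → 𝟙 (fixed? σ v)) ⟩
  ∑ (upTo q) (λ i → ∑ (words q n) (λ v → 𝟙 (fixed? σ (suc i ∷ v))))
    ≡⟨ ∑-comm (upTo q) (words q n) (λ i v → 𝟙 (fixed? σ (suc i ∷ v))) ⟩
  ∑ (words q n) (λ v → ∑ (upTo q) (λ i → 𝟙 (fixed? σ (suc i ∷ v))))
    ≡⟨ ∑-cong-∈ (words q n) determined ⟩
  ∑ (words q n) (λ v → 𝟙 (fixed? π v))
    ≡⟨ hyp ⟩
  ι (q ^ length (cycleType π))
    ≡⟨ cong (λ l → ι (q ^ l)) (length-insert-suc π k) ⟨
  ι (q ^ length (cycleType σ))
    ∎
  where
  σ = insert π (Fin.suc k)
  determined : ∀ {v} → v ∈ words q n →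
               ∑ (upTo q) (λ i → 𝟙 (fixed? σ (suc i ∷ v))) ≡ 𝟙 (fixed? π v)
  determined {v} v∈ = begin
    ∑ (upTo q) (λ i → 𝟙 (fixed? σ (suc i ∷ v)))
      ≡⟨ ∑-cong (upTo q) (λ i → fixed-insert-suc π k (suc i) v) ⟩
    ∑ (upTo q) (λ i → 𝟙 (fixed? π v) ℚ.* 𝟙 (lookup v k ℕ.≟ suc i))
      ≡⟨ ∑-*ˡ (upTo q) (𝟙 (fixed? π v)) (λ i → 𝟙 (lookup v k ℕ.≟ suc i)) ⟩
    𝟙 (fixed? π v) ℚ.* ∑ (upTo q) (λ i → 𝟙 (lookup v k ℕ.≟ suc i))
      ≡⟨ cong (𝟙 (fixed? π v) ℚ.*_) (∑-letter q (lookup-letter (∈-words⁻ q n v∈) k)) ⟩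
    𝟙 (fixed? π v) ℚ.* 1ℚ
      ≡⟨ ℚ.*-identityʳ _ ⟩
    𝟙 (fixed? π v)
      ∎

fixedWordCount : ∀ q n {w} → w ∈ permutations n → FixedWordCount q w
fixedWordCount q zero    (here refl) = refl
fixedWordCount q (suc n) w∈ =
  case ∈-cartesianProductWith⁻ (λ j π → insert π j) (allFin (suc n)) (permutations n) w∈ of λ where
    (Fin.zero  , π , _ , π∈ , eq) → subst (FixedWordCount q) (sym eq)
      (fixedWordCount-insert-zero q π (fixedWordCount q n π∈))
    (Fin.suc k , π , _ , π∈ , eq) → subst (FixedWordCount q) (sym eq)
      (fixedWordCount-insert-suc q π k (fixedWordCount q n π∈))

-- First minima and their shift

-- The times considered are 0, ..., n. Strictness before r and weakness after r single out one
-- minimum among ties.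
FirstMinimum : ℕ → (ℕ → ℕ) → ℕ → Set
FirstMinimum n h r = ∀ {t} → t < suc n → (t < r → h r < h t) × (r ≤ t → h r ≤ h t)

firstMinimum? : ∀ n h r → Dec (FirstMinimum n h r)
firstMinimum? n h r = ℕ.allUpTo?
  (λ t → (t ℕ.<? r →-dec h r ℕ.<? h t) ×-dec (r ℕ.≤? t →-dec h r ℕ.≤? h t)) (suc n)

firstMinimum-≤ : ∀ {n h r t} → FirstMinimum n h r → t < suc n → h r ≤ h t
firstMinimum-≤ {r = r} {t} min t≤n = case t ℕ.<? r of λ where
  (yes t<r) → ℕ.<⇒≤ (proj₁ (min t≤n) t<r)
  (no  t≮r) → proj₂ (min t≤n) (ℕ.≮⇒≥ t≮r)

firstMinimum-exists : ∀ n h → ∃ λ r → r < suc n × FirstMinimum n h r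
firstMinimum-exists zero    h = 0 , s≤s z≤n , λ { (s≤s z≤n) → (λ ()) , λ _ → ℕ.≤-refl }
firstMinimum-exists (suc n) h with firstMinimum-exists n h
... | r , r≤n , min with h (suc n) ℕ.<? h r
...   | yes new = suc n , ℕ.≤-refl , λ {t} t≤1+n →
          (λ t<1+n → ℕ.<-≤-trans new (firstMinimum-≤ {h = h} min t<1+n)) ,
          (λ 1+n≤t → ℕ.≤-reflexive (cong h (ℕ.≤-antisym 1+n≤t (s≤s⁻¹ t≤1+n))))
...   | no old = r , ℕ.m≤n⇒m≤1+n r≤n , λ {t} t≤1+n → case ℕ.m≤n⇒m<n∨m≡n (s≤s⁻¹ t≤1+n) of λ where
          (inj₁ t<1+n) → min t<1+n
          (inj₂ refl)  → (λ 1+n<r → contradiction (ℕ.≤-trans 1+n<r (s≤s⁻¹ r≤n)) (ℕ.<⇒≱ (s≤s (ℕ.n≤1+n n)))) ,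
                         (λ _ → ℕ.≮⇒≥ old)

firstMinimum-unique : ∀ {n h r s} → r < suc n → s < suc n →
                      FirstMinimum n h r → FirstMinimum n h s → r ≡ s
firstMinimum-unique {h = h} {r} {s} r≤n s≤n min-r min-s = case ℕ.<-cmp r s of λ where
  (tri< r<s _ _) → contradiction (firstMinimum-≤ {h = h} min-r s≤n) (ℕ.<⇒≱ (proj₁ (min-s r≤n) r<s))
  (tri≈ _ r≡s _) → r≡s
  (tri> _ _ s<r) → contradiction (firstMinimum-≤ {h = h} min-s r≤n) (ℕ.<⇒≱ (proj₁ (min-r s≤n) s<r))

∑-firstMinimum : ∀ n h → ∑ (upTo (suc n)) (λ r → 𝟙 (firstMinimum? n h r)) ≡ 1ℚ
∑-firstMinimum n h with firstMinimum-exists n h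
... | r , r≤n , min = trans
  (∑-unique (Unique.upTo⁺ (suc n)) (∈-upTo⁺ r≤n) λ {s} s∈ s≢r → 𝟙-no (firstMinimum? n h s) λ min-s →
    s≢r (firstMinimum-unique {h = h} (∈-upTo⁻ s∈) r≤n min-s min))
  (𝟙-yes (firstMinimum? n h r) min)

-- What a rotation does to a path: `slide` says that `h′` is `h` with the origin moved by one time
-- step, up to a constant, and `wrap` that `h` loses 1 over a full turn.
module _ {n} {h h′ : ℕ → ℕ} {c}
         (slide : ∀ {t} → t ≤ n → suc (h (suc t)) ≡ h′ t + c) (wrap : h 0 ≡ suc (h (suc n))) where

  shift-≤⁻ : ∀ {s t} → s ≤ n → t ≤ n → h′ s ≤ h′ t → h (suc s) ≤ h (suc t)
  shift-≤⁻ s≤n t≤n le = s≤s⁻¹ (subst₂ _≤_ (sym (slide s≤n)) (sym (slide t≤n)) (ℕ.+-monoˡ-≤ c le))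

  shift-≤⁺ : ∀ {s t} → s ≤ n → t ≤ n → h (suc s) ≤ h (suc t) → h′ s ≤ h′ t
  shift-≤⁺ {s} {t} s≤n t≤n le = ℕ.+-cancelʳ-≤ c (h′ s) (h′ t) (subst₂ _≤_ (slide s≤n) (slide t≤n) (s≤s le))

  shift-<⁻ : ∀ {s t} → s ≤ n → t ≤ n → h′ s < h′ t → h (suc s) < h (suc t)
  shift-<⁻ s≤n t≤n lt = s≤s⁻¹ (subst₂ _<_ (sym (slide s≤n)) (sym (slide t≤n)) (ℕ.+-monoˡ-< c lt))

  shift-<⁺ : ∀ {s t} → s ≤ n → t ≤ n → h (suc s) < h (suc t) → h′ s < h′ t
  shift-<⁺ {s} {t} s≤n t≤n lt = ℕ.+-cancelʳ-< c (h′ s) (h′ t) (subst₂ _<_ (slide s≤n) (slide t≤n) (s≤s lt))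

  -- Time 0 leaves the window at the front and returns as time n + 1 at the back, one lower. So
  -- `h (suc r) < h 0` amounts to `h′ r ≤ h′ n`, just as strictness before and weakness after the
  -- minimum demand; all other comparisons merely slide.
  firstMinimum-shift⁺ : ∀ {r} → suc r ≤ n → FirstMinimum n h′ r → FirstMinimum n h (suc r)
  firstMinimum-shift⁺ {r} r<n min {zero} _ =
    (λ _ → subst (h (suc r) <_) (sym wrap)
      (s≤s (shift-≤⁻ (ℕ.<⇒≤ r<n) ℕ.≤-refl (proj₂ (min ℕ.≤-refl) (ℕ.<⇒≤ r<n))))) ,
    (λ ())
  firstMinimum-shift⁺ {r} r<n min {suc t} (s≤s t<n) =
    (λ t<r → shift-<⁻ (ℕ.<⇒≤ r<n) (ℕ.<⇒≤ t<n) (proj₁ (min (ℕ.m≤n⇒m≤1+n t<n)) (s≤s⁻¹ t<r))) ,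
    (λ r≤t → shift-≤⁻ (ℕ.<⇒≤ r<n) (ℕ.<⇒≤ t<n) (proj₂ (min (ℕ.m≤n⇒m≤1+n t<n)) (s≤s⁻¹ r≤t)))

  firstMinimum-shift⁻ : ∀ {r} → suc r ≤ n → FirstMinimum n h (suc r) → FirstMinimum n h′ r
  firstMinimum-shift⁻ {r} r<n min {t} (s≤s t≤n) = case ℕ.m≤n⇒m<n∨m≡n t≤n of λ where
    (inj₁ t<n)  → (λ t<r → shift-<⁺ (ℕ.<⇒≤ r<n) t≤n (proj₁ (min (s≤s t<n)) (s≤s t<r))) ,
                  (λ r≤t → shift-≤⁺ (ℕ.<⇒≤ r<n) t≤n (proj₂ (min (s≤s t<n)) (s≤s r≤t)))
    (inj₂ refl) → (λ n<r → contradiction (ℕ.<-trans r<n n<r) (ℕ.<-irrefl refl)) ,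
                  (λ _ → shift-≤⁺ (ℕ.<⇒≤ r<n) t≤n
                    (s≤s⁻¹ (subst (h (suc r) <_) wrap (proj₁ (min (s≤s z≤n)) (s≤s z≤n)))))

-- Paths of words and parking functions

count : ℕ → List ℕ → ℕ
count t = length ∘ filter (ℕ._≤? t)

count-≤ : ∀ {t a} xs → a ≤ t → count t (a ∷ xs) ≡ suc (count t xs)
count-≤ {t} {a} xs a≤t = cong length (List.filter-accept (ℕ._≤? t) {a} {xs} a≤t)

count-≰ : ∀ {t a} xs → ¬ a ≤ t → count t (a ∷ xs) ≡ count t xs
count-≰ {t} {a} xs a≰t = cong length (List.filter-reject (ℕ._≤? t) {a} {xs} a≰t)

count-all : ∀ {t xs} → All (_≤ t) xs → count t xs ≡ length xs
count-all {t} all≤ = cong length (List.filter-all (ℕ._≤? t) all≤)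

count-none : ∀ {t xs} → All (λ a → ¬ a ≤ t) xs → count t xs ≡ 0
count-none {t} none≤ = cong length (List.filter-none (ℕ._≤? t) none≤)

-- Rotation takes the letters 2, ..., t + 1 to 1, ..., t and each letter 1 to n + 1, which is beyond
-- t. So exactly the letters 1 are lost.
count-rotate : ∀ {n t} → t ≤ n → (v : Vec ℕ ℓ) → Letters (suc n) v →
  count t (toList (rotate (suc n) v)) + count 1 (toList v) ≡ count (suc t) (toList v)
count-rotate t≤n [] [] = refl
count-rotate {n = n} {t} t≤n (suc zero ∷ v) (_ ∷ ls) = begin
  count t (suc n ∷ u) + count 1 (1 ∷ toList v)
    ≡⟨ cong₂ _+_ (count-≰ u (ℕ.<⇒≱ (s≤s t≤n))) (count-≤ (toList v) ℕ.≤-refl) ⟩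
  count t u + suc (count 1 (toList v))
    ≡⟨ ℕ.+-suc (count t u) _ ⟩
  suc (count t u + count 1 (toList v))
    ≡⟨ cong suc (count-rotate t≤n v ls) ⟩
  suc (count (suc t) (toList v))
    ≡⟨ count-≤ (toList v) (s≤s z≤n) ⟨
  count (suc t) (1 ∷ toList v)
    ∎
  where u = toList (rotate (suc n) v)
count-rotate {n = n} {t} t≤n (suc (suc a) ∷ v) (_ ∷ ls) = case suc a ℕ.≤? t of λ where
    (yes a≤t) → begin
      count t (suc a ∷ u) + count 1 (suc (suc a) ∷ toList v)
        ≡⟨ cong₂ _+_ (count-≤ u a≤t) (count-≰ (toList v) 2+a≰1) ⟩
      suc (count t u + count 1 (toList v))
        ≡⟨ cong suc (count-rotate t≤n v ls) ⟩
      suc (count (suc t) (toList v))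
        ≡⟨ count-≤ (toList v) (s≤s a≤t) ⟨
      count (suc t) (suc (suc a) ∷ toList v)
        ∎
    (no a≰t) → begin
      count t (suc a ∷ u) + count 1 (suc (suc a) ∷ toList v)
        ≡⟨ cong₂ _+_ (count-≰ u a≰t) (count-≰ (toList v) 2+a≰1) ⟩
      count t u + count 1 (toList v)
        ≡⟨ count-rotate t≤n v ls ⟩
      count (suc t) (toList v)
        ≡⟨ count-≰ (toList v) (a≰t ∘ s≤s⁻¹) ⟨
      count (suc t) (suc (suc a) ∷ toList v)
        ∎
  where
  u = toList (rotate (suc n) v)
  2+a≰1 : ¬ suc (suc a) ≤ 1
  2+a≰1 (s≤s ())

-- The path t ↦ count t v − t, raised by n + 1 to stay in ℕ.  Parking functions
-- are the words whose path never goes below its start, and rotating the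
-- alphabet moves the start by one.
height : Vec ℕ n → ℕ → ℕ
height {n} v t = count t (toList v) + (suc n ∸ t)

-- The hypothesis `slide`, with the number of letters 1 as constant.
height-rotate : ∀ (v : Vec ℕ n) → Letters (suc n) v → ∀ {t} → t ≤ n →
  suc (height v (suc t)) ≡ height (rotate (suc n) v) t + count 1 (toList v)
height-rotate {n} v ls {t} t≤n = begin
  suc (count (suc t) (toList v) + (n ∸ t))
    ≡⟨ cong (λ c → suc (c + (n ∸ t))) (count-rotate t≤n v ls) ⟨
  suc (c′ + c₁ + (n ∸ t))
    ≡⟨ cong suc (xy∙z≈xz∙y c′ c₁ (n ∸ t)) ⟩
  suc (c′ + (n ∸ t) + c₁)
    ≡⟨ cong (_+ c₁) (ℕ.+-suc c′ (n ∸ t)) ⟨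
  c′ + suc (n ∸ t) + c₁
    ≡⟨ cong (λ k → c′ + k + c₁) (ℕ.+-∸-assoc 1 t≤n) ⟨
  c′ + (suc n ∸ t) + c₁
    ∎
  where
  c′ = count t (toList (rotate (suc n) v))
  c₁ = count 1 (toList v)

count-0 : ∀ {k} (v : Vec ℕ n) → Letters k v → count 0 (toList v) ≡ 0
count-0 v ls = count-none (All.map (λ (1≤a , _) → ℕ.<⇒≱ 1≤a) ls)

-- The hypothesis `wrap`: over n + 1 time steps the path gains all n letters and loses n + 1.
height-wrap : ∀ (v : Vec ℕ n) → Letters (suc n) v → height v 0 ≡ suc (height v (suc n))
height-wrap {n} v ls = begin
  count 0 (toList v) + suc n              ≡⟨ cong (_+ suc n) (count-0 v ls) ⟩
  suc n                                   ≡⟨ cong suc (Vec.length-toList v) ⟨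
  suc (length (toList v))                 ≡⟨ cong suc (count-all (All.map proj₂ ls)) ⟨
  suc (count (suc n) (toList v))          ≡⟨ cong suc (ℕ.+-identityʳ _) ⟨
  suc (count (suc n) (toList v) + 0)      ≡⟨ cong (λ k → suc (count (suc n) (toList v) + k)) (ℕ.n∸n≡0 (suc n)) ⟨
  suc (height v (suc n))                  ∎

sorted-tail-≤ : ∀ {x xs} → Linked _≤_ (x ∷ xs) → All (x ≤_) xs
sorted-tail-≤ sorted = case Linked.Linked⇒AllPairs ℕ.≤-trans sorted of λ where
  (x≤ ∷ _) → x≤

sorted-none : ∀ {t x xs} → Linked _≤_ (x ∷ xs) → ¬ x ≤ t → All (λ a → ¬ a ≤ t) (x ∷ xs)
sorted-none sorted x≰t = x≰t ∷ All.map (λ x≤a a≤t → x≰t (ℕ.≤-trans x≤a a≤t)) (sorted-tail-≤ sorted)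

-- In a sorted list the entries ≤ t form an initial segment, and `count t xs` is its length.
lookup-count⁺ : ∀ {t xs} → Linked _≤_ xs → ∀ i → List.lookup xs i ≤ t → toℕ i < count t xs
lookup-count⁺ {t} {x ∷ xs} sorted i l≤t = case x ℕ.≤? t of λ where
    (yes x≤t) → subst (toℕ i <_) (sym (count-≤ xs x≤t)) (accepted i l≤t)
    (no  x≰t) → contradiction l≤t (All.lookup (sorted-none sorted x≰t) (∈-lookup i))
  where
  accepted : ∀ i → List.lookup (x ∷ xs) i ≤ t → toℕ i < suc (count t xs)
  accepted Fin.zero    _   = s≤s z≤n
  accepted (Fin.suc i) l≤t = s≤s (lookup-count⁺ (Linked.tail sorted) i l≤t)

lookup-count⁻ : ∀ {t xs} → Linked _≤_ xs → ∀ i → toℕ i < count t xs → List.lookup xs i ≤ t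
lookup-count⁻ {t} {x ∷ xs} sorted i i<c = case x ℕ.≤? t of λ where
    (yes x≤t) → accepted x≤t i (subst (toℕ i <_) (count-≤ xs x≤t) i<c)
    (no  x≰t) → contradiction (subst (toℕ i <_) (count-none (sorted-none sorted x≰t)) i<c) λ ()
  where
  accepted : x ≤ t → ∀ i → toℕ i < suc (count t xs) → List.lookup (x ∷ xs) i ≤ t
  accepted x≤t Fin.zero    _   = x≤t
  accepted x≤t (Fin.suc i) i<c = lookup-count⁻ (Linked.tail sorted) i (s≤s⁻¹ i<c)

module _ {n} (v : Vec ℕ n) where

  private
    b = sort (toList v)

  length-sorted : length b ≡ n
  length-sorted = trans (↭-length (sort-↭ (toList v))) (Vec.length-toList v)

  count-sorted : ∀ t → count t b ≡ count t (toList v)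
  count-sorted t = ↭-length (filter-↭ (ℕ._≤? t) (sort-↭ (toList v)))

  -- The sorted entry at index t, counted from 0, is at most t + 1, so its index lies below the
  -- number of letters ≤ t + 1.
  parking⇒count : IsParkingFunction v → ∀ {t} → t ≤ n → t ≤ count t (toList v)
  parking⇒count h {zero}  t≤n = z≤n
  parking⇒count h {suc t} t<n = subst (suc t ≤_) (count-sorted (suc t))
    (subst (λ k → suc k ≤ count (suc t) b) (Fin.toℕ-fromℕ< t<b)
      (lookup-count⁺ (sort-↗ (toList v)) i (subst (λ k → List.lookup b i ≤ suc k)
        (Fin.toℕ-fromℕ< t<b) (IsParkingFunction.parked h i))))
    where
    t<b = subst (t <_) (sym length-sorted) t<n
    i = fromℕ< t<b

  count⇒parking : All (1 ≤_) (toList v) → (∀ {t} → t ≤ n → t ≤ count t (toList v)) → IsParkingFunction v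
  count⇒parking pos h = isParkingFunction pos λ i → lookup-count⁻ (sort-↗ (toList v)) i
    (subst (suc (toℕ i) ≤_) (sym (count-sorted (suc (toℕ i))))
      (h (subst (toℕ i <_) length-sorted (Fin.toℕ<n i))))

  -- The path starts at height n + 1, and being at least that high at time t means `t ≤ count t`. No
  -- time precedes 0, so the strict condition is vacuous.
  parking⇒firstMinimum : ∀ {k} → Letters k v → IsParkingFunction v → FirstMinimum n (height v) 0
  parking⇒firstMinimum ls h {t} (s≤s t≤n) = (λ ()) , λ _ →
    subst (λ c → c + suc n ≤ height v t) (sym (count-0 v ls))
      (subst (_≤ height v t) (ℕ.m+[n∸m]≡n (ℕ.m≤n⇒m≤1+n t≤n))
        (ℕ.+-monoˡ-≤ (suc n ∸ t) (parking⇒count h t≤n)))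

  firstMinimum⇒parking : ∀ {k} → Letters k v → FirstMinimum n (height v) 0 → IsParkingFunction v
  firstMinimum⇒parking ls min = count⇒parking (All.map proj₁ ls) λ {t} t≤n →
    ℕ.+-cancelʳ-≤ (suc n ∸ t) t (count t (toList v))
      (subst (_≤ height v t) (sym (ℕ.m+[n∸m]≡n (ℕ.m≤n⇒m≤1+n t≤n)))
        (subst (λ c → c + suc n ≤ height v t) (count-0 v ls) (proj₂ (min (s≤s t≤n)) z≤n)))

parking-letters : ∀ (v : Vec ℕ n) → IsParkingFunction v → Letters n v
parking-letters {n} v h = ∈-words⁻ n n
  (proj₁ (∈-filter⁻ isParkingFunction? {xs = words n n} (∈-parkingFunctions h)))

-- For r = 0 these are the fixed parking functions; rotation makes the number
-- independent of r, and every word has exactly one first minimum.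
fixedFirstMinima : Permutation′ n → ℕ → ℚ
fixedFirstMinima {n} w r =
  ∑ (words (suc n) n) (λ v → 𝟙 (firstMinimum? n (height v) r) ℚ.* 𝟙 (fixed? w v))

fixedFirstMinima-zero : ∀ (w : Permutation′ n) → fixedFirstMinima w 0 ≡ parkingCharacter n w
fixedFirstMinima-zero {n} w = begin
  ∑ (words (suc n) n) (λ v → 𝟙 (firstMinimum? n (height v) 0) ℚ.* 𝟙 (fixed? w v))
    ≡⟨ ∑-cong-∈ (words (suc n) n) (λ {v} v∈ → cong (ℚ._* 𝟙 (fixed? w v))
         (let ls = ∈-words⁻ (suc n) n v∈ in 𝟙-cong (firstMinimum? n (height v) 0) (isParkingFunction? v)
           (firstMinimum⇒parking v ls) (λ h {t} → parking⇒firstMinimum v ls h {t}))) ⟩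
  ∑ (words (suc n) n) f
    ≡⟨ ∑-words-restrict n n f (λ {v} n+1∈v → trans
         (cong (ℚ._* 𝟙 (fixed? w v)) (𝟙-no (isParkingFunction? v) λ h →
           ℕ.<⇒≱ ℕ.≤-refl (proj₂ (All.lookup (parking-letters v h) n+1∈v))))
         (ℚ.*-zeroˡ (𝟙 (fixed? w v)))) ⟩
  ∑ (words n n) f
    ≡⟨ ∑-filter isParkingFunction? (words n n) (λ v → 𝟙 (fixed? w v)) ⟨
  parkingCharacter n w
    ∎
  where
  f : Vec ℕ n → ℚ
  f v = 𝟙 (isParkingFunction? v) ℚ.* 𝟙 (fixed? w v)

-- A first minimum at r + 1 in a word is one at r in the rotated word; reindexing by the rotation
-- then removes it from the sum.
fixedFirstMinima-suc : ∀ (w : Permutation′ n) {r} → suc r ≤ n →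
                       fixedFirstMinima w (suc r) ≡ fixedFirstMinima w r
fixedFirstMinima-suc {n} w {r} r<n = begin
  fixedFirstMinima w (suc r)
    ≡⟨ ∑-cong-∈ (words (suc n) n) (λ {v} v∈ → let ls = ∈-words⁻ (suc n) n v∈ in
         cong₂ ℚ._*_ (𝟙-cong (firstMinimum? n (height v) (suc r)) (firstMinimum? n (height (rotate (suc n) v)) r)
           (λ min {t} → firstMinimum-shift⁻ {h = height v} (height-rotate v ls) (height-wrap v ls) r<n min {t})
           (λ min {t} → firstMinimum-shift⁺ {h = height v} (height-rotate v ls) (height-wrap v ls) r<n min {t}))
           (sym (fixed-rotate w ls))) ⟩
  ∑ (words (suc n) n) (f ∘ rotate (suc n))
    ≡⟨ ∑-words-rotate n n f ⟩
  fixedFirstMinima w r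
    ∎
  where
  f : Vec ℕ n → ℚ
  f v = 𝟙 (firstMinimum? n (height v) r) ℚ.* 𝟙 (fixed? w v)

fixedFirstMinima-constant : ∀ (w : Permutation′ n) r → r ≤ n → fixedFirstMinima w r ≡ parkingCharacter n w
fixedFirstMinima-constant w zero    r≤n = fixedFirstMinima-zero w
fixedFirstMinima-constant w (suc r) r<n =
  trans (fixedFirstMinima-suc w r<n) (fixedFirstMinima-constant w r (ℕ.<⇒≤ r<n))

suc-n*parkingCharacter : ∀ n {w} → w ∈ permutations n →
  ι (suc n) ℚ.* parkingCharacter n w ≡ ι (suc n ^ length (cycleType w))
suc-n*parkingCharacter n {w} w∈ = begin
  ι (suc n) ℚ.* parkingCharacter n w
    ≡⟨ ∑-const (suc n) (parkingCharacter n w) ⟨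
  ∑ (upTo (suc n)) (λ _ → parkingCharacter n w)
    ≡⟨ ∑-upTo-cong (suc n) (λ r r≤n → fixedFirstMinima-constant w r (s≤s⁻¹ r≤n)) ⟨
  ∑ (upTo (suc n)) (fixedFirstMinima w)
    ≡⟨ ∑-comm (upTo (suc n)) (words (suc n) n) (λ r v → 𝟙 (firstMinimum? n (height v) r) ℚ.* 𝟙 (fixed? w v)) ⟩
  ∑ (words (suc n) n) (λ v → ∑ (upTo (suc n)) λ r → 𝟙 (firstMinimum? n (height v) r) ℚ.* 𝟙 (fixed? w v))
    ≡⟨ ∑-cong (words (suc n) n) (λ v → begin
         ∑ (upTo (suc n)) (λ r → 𝟙 (firstMinimum? n (height v) r) ℚ.* 𝟙 (fixed? w v))
           ≡⟨ ∑-*ʳ (upTo (suc n)) (𝟙 (fixed? w v)) (λ r → 𝟙 (firstMinimum? n (height v) r)) ⟩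
         ∑ (upTo (suc n)) (λ r → 𝟙 (firstMinimum? n (height v) r)) ℚ.* 𝟙 (fixed? w v)
           ≡⟨ cong (ℚ._* 𝟙 (fixed? w v)) (∑-firstMinimum n (height v)) ⟩
         1ℚ ℚ.* 𝟙 (fixed? w v)
           ≡⟨ ℚ.*-identityˡ _ ⟩
         𝟙 (fixed? w v)
           ∎) ⟩
  ∑ (words (suc n) n) (λ v → 𝟙 (fixed? w v))
    ≡⟨ fixedWordCount (suc n) n w∈ ⟩
  ι (suc n ^ length (cycleType w))
    ∎

cycleType-nonempty : n ≥ 1 → ∀ (w : Permutation′ n) → ∃ λ l → length (cycleType w) ≡ suc l
cycleType-nonempty (s≤s _) w = nonempty (proj₁ (proj₂ (leader w Fin.zero)))
  where
  nonempty : ∀ {i L} → i ∈ L → ∃ λ l → length (map (cycleLength w) L) ≡ suc l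
  nonempty {L = _ ∷ L} _ = length (map (cycleLength w) L) , refl

-- As n ≥ 1, the permutation has at least one cycle; so `∸ 1` is a true subtraction and a factor n +
-- 1 can be cancelled.
parkingCharacter-cycleType : ∀ n → n ≥ 1 → ∀ {w} → w ∈ permutations n →
  parkingCharacter n w ≡ ι ((n + 1) ^ (length (cycleType w) ∸ 1))
parkingCharacter-cycleType n n≥1 {w} w∈ = divide (cycleType-nonempty n≥1 w)
  where
  divide : (∃ λ l → length (cycleType w) ≡ suc l) →
           parkingCharacter n w ≡ ι ((n + 1) ^ (length (cycleType w) ∸ 1))
  divide (l , len≡) = begin
    parkingCharacter n w                        ≡⟨ ι-cancelˡ (suc n) power ⟩
    ι (suc n ^ l)                               ≡⟨ cong (λ N → ι (N ^ l)) (ℕ.+-comm 1 n) ⟩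
    ι ((n + 1) ^ l)                             ≡⟨ cong (λ k → ι ((n + 1) ^ (k ∸ 1))) len≡ ⟨
    ι ((n + 1) ^ (length (cycleType w) ∸ 1))    ∎
    where
    power : ι (suc n) ℚ.* parkingCharacter n w ≡ ι (suc n) ℚ.* ι (suc n ^ l)
    power = begin
      ι (suc n) ℚ.* parkingCharacter n w   ≡⟨ suc-n*parkingCharacter n w∈ ⟩
      ι (suc n ^ length (cycleType w))     ≡⟨ cong (λ k → ι (suc n ^ k)) len≡ ⟩
      ι (suc n ^ suc l)                    ≡⟨ ι-* (suc n) (suc n ^ l) ⟩
      ι (suc n) ℚ.* ι (suc n ^ l)          ∎

theorem2p1 : (n : ℕ) → n ≥ 1 →
    PF n [x/x]≈ ∑Λ (oddPartitions n) λ μ →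
    (z⁻¹ μ ℚ.* (+ (2 ^ length μ * (n + 1) ^ (length μ ∸ 1)) / 1)) • p⟨ μ ⟩
theorem2p1 n n≥1 = PFₙ , ⟦frobeniusPoly⟧p n (parkingCharacter n) , λ α → begin
  coeff (∑Λ (oddPartitions n) rhs) α
    ≡⟨ coeff-∑Λ (oddPartitions n) rhs α ⟩
  ∑ (oddPartitions n) (λ μ → coeff (rhs μ) α)
    ≡⟨ ∑-cong-∈ (oddPartitions n) (λ {μ} μ∈ →
         odd-term α μ (proj₂ (∈-filter⁻ odd? {xs = partitions n} μ∈))) ⟩
  ∑ (oddPartitions n) (λ μ → z⁻¹ μ ℚ.* F α μ)
    -- An even part kills the shifted monomial, so the sum extends to all partitions and takes the
    -- form of `average-partitions`.
    ≡⟨ ∑-filter-support odd? (partitions n) (λ μ → z⁻¹ μ ℚ.* F α μ) (λ {μ} _ ¬odd → trans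
         (cong (z⁻¹ μ ℚ.*_) (trans
           (cong (ι (N^ μ) ℚ.*_) (monomial-shifted-even ¬odd α))
           (ℚ.*-zeroʳ (ι (N^ μ)))))
         (ℚ.*-zeroʳ (z⁻¹ μ))) ⟩
  ∑ (partitions n) (λ μ → z⁻¹ μ ℚ.* F α μ)
    ≡⟨ average-partitions n (F-symmetric α) ⟨
  average n (F α)
    -- Membership in `permutations n` matters here, because fixed words are counted along the
    -- insertions that build a listed permutation.
    ≡⟨ cong (inv (n !) {{n ℕ.!≢0}} ℚ.*_) (∑-cong-∈ (permutations n) λ {w} w∈ →
         cong (ℚ._* coeff (⟦ monomial (cycleType w) ⟧ shiftedPowerSum) α)
           (parkingCharacter-cycleType n n≥1 w∈)) ⟨
  inv (n !) {{n ℕ.!≢0}} ℚ.* ∑ (permutations n) (λ w →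
    parkingCharacter n w ℚ.* coeff (⟦ monomial (cycleType w) ⟧ shiftedPowerSum) α)
    ≡⟨ coeff-frobeniusPoly n (parkingCharacter n) shiftedPowerSum α ⟨
  coeff (⟦ PFₙ ⟧ shiftedPowerSum) α
    ∎
  where
  PFₙ = frobeniusPoly n (parkingCharacter n)
  odd? = All.all? (λ k → ¬? (2 ∣? k))
  N^ : List ℕ → ℕ
  N^ μ = (n + 1) ^ (length μ ∸ 1)
  rhs : List ℕ → Λ
  rhs μ = (z⁻¹ μ ℚ.* ι (2 ^ length μ * N^ μ)) • p⟨ μ ⟩
  F : Exponents → List ℕ → ℚ
  F α μ = ι (N^ μ) ℚ.* coeff (⟦ monomial μ ⟧ shiftedPowerSum) α
  F-symmetric : ∀ α → Symmetric (F α)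
  F-symmetric α r = cong₂ (λ l c → ι ((n + 1) ^ (l ∸ 1)) ℚ.* c)
    (↭-length r) (monomial-↭ shiftedPowerSum r α)
  odd-term : ∀ α μ → All Odd μ → coeff (rhs μ) α ≡ z⁻¹ μ ℚ.* F α μ
  odd-term α μ odd = begin
    z⁻¹ μ ℚ.* ι (2 ^ length μ * N^ μ) ℚ.* c
      ≡⟨ cong (λ q → z⁻¹ μ ℚ.* q ℚ.* c) (ι-* (2 ^ length μ) (N^ μ)) ⟩
    z⁻¹ μ ℚ.* (ι (2 ^ length μ) ℚ.* ι (N^ μ)) ℚ.* c
      ≡⟨ solve 4 (λ a b d c → (a ⊠ (b ⊠ d)) ⊠ c := a ⊠ (d ⊠ (b ⊠ c))) refl
           (z⁻¹ μ) (ι (2 ^ length μ)) (ι (N^ μ)) c ⟩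
    z⁻¹ μ ℚ.* (ι (N^ μ) ℚ.* (ι (2 ^ length μ) ℚ.* c))
      ≡⟨ cong (λ q → z⁻¹ μ ℚ.* (ι (N^ μ) ℚ.* q)) (monomial-shifted-odd odd α) ⟨
    z⁻¹ μ ℚ.* F α μ
      ∎
    where c = coeff p⟨ μ ⟩ α
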